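{- Let $(P_n)$ be a sequence of finite posets. Then the following are equivalent: (i) $t(Q,P_n)$ converges for every finite poset $Q$, and $|P_n|$ converges to some limit in $\mathbb N\cup\{\infty\}$; (ii) $t_{\mathrm{inj}}(Q,P_n)$ converges for every finite poset $Q$; (iii) $t_{\mathrm{ind}}(Q,P_n)$ converges for every finite poset $Q$; (iv) $t(F,P_n)$ converges for every finite digraph $F$, and $|P_n|$ converges to some limit in $\mathbb N\cup\{\infty\}$; (v) $t_{\mathrm{inj}}(F,P_n)$ converges for every finite digraph $F$; (vi) $t_{\mathrm{ind}}(F,P_n)$ converges for every finite digraph $F$.
   Context: A digraph $G$ has a non-empty vertex set $V(G)$ and edge set $E(G)\subseteq V(G)\times V(G)$ (loops allowed). A poset $P$ is regarded as the digraph on its ground set with an edge $i\to j$ iff $i<_Pj$. For finite digraphs $F,G$ (in particular posets): $t(F,G)$ is the proportion of all maps $\varphi:V(F)\to V(G)$ such that $ij\in E(F)\Rightarrow\varphi(i)\varphi(j)\in E(G)$; $t_{\mathrm{inj}}(F,G)$ is the proportion of injective maps with this property; $t_{\mathrm{ind}}(F,G)$ is the proportion of injective maps with $ij\in E(F)\iff\varphi(i)\varphi(j)\in E(G)$; if $|F|>|G|$, set $t_{\mathrm{inj}}(F,G)=t_{\mathrm{ind}}(F,G)=0$. For posets these agree with the poset notions (homomorphisms $x<_Qy\Rightarrow\varphi(x)<_P\varphi(y)$, etc.). -}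

module Defs where

open import Data.Nat using (ℕ; zero; suc; _≤_; _<_)
open import Data.Fin using (Fin; zero; suc)
open import Data.Fin.Properties using (_≟_)
open import Data.Bool using (Bool; true; false; _∧_; _∨_; not; if_then_else_)
open import Data.List using (List; []; _∷_; map; concatMap; filter; length; allFin)
open import Data.Integer using (+_)
open import Data.Rational using (ℚ; 0ℚ; _/_; _-_; ∣_∣) renaming (_<_ to _<ℚ_)
open import Data.Maybe using (Maybe; just; nothing)
open import Data.Product using (Σ; ∃; _×_)
open import Relation.Binary.PropositionalEquality using (_≡_)
open import Relation.Nullary.Decidable using (⌊_⌋)

record Digraph : Set where
  field
    size     : ℕ
    nonempty : 1 ≤ size
    edge     : Fin size → Fin size → Bool

-- Finite posets: a (non-empty) ground set Fin size with a strict order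
-- i <_P j  iff  lt i j ≡ true (irreflexive and transitive; antisymmetry
-- follows).
record Poset : Set where
  field
    size     : ℕ
    nonempty : 1 ≤ size
    lt       : Fin size → Fin size → Bool
    irrefl   : ∀ i → lt i i ≡ false
    trans    : ∀ i j k → lt i j ≡ true → lt j k ≡ true → lt i k ≡ true

toDigraph : Poset → Digraph
toDigraph P = record { size = Poset.size P ; nonempty = Poset.nonempty P ; edge = Poset.lt P }

extend : ∀ {k m} → Fin m → (Fin k → Fin m) → (Fin (suc k) → Fin m)
extend a f zero    = a
extend a f (suc i) = f i

allMaps : (k m : ℕ) → List (Fin k → Fin m)
allMaps zero    m = (λ ()) ∷ []
allMaps (suc k) m = concatMap (λ a → map (extend a) (allMaps k m)) (allFin m)

_⇒b_ : Bool → Bool → Bool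
a ⇒b b = not a ∨ b

_⇔b_ : Bool → Bool → Bool
true  ⇔b b = b
false ⇔b b = not b

eqFin : ∀ {m} → Fin m → Fin m → Bool
eqFin a b = ⌊ a ≟ b ⌋

allb : ∀ {A : Set} → (A → Bool) → List A → Bool
allb p []       = true
allb p (x ∷ xs) = p x ∧ allb p xs

forallPairs : ∀ {k} → (Fin k → Fin k → Bool) → Bool
forallPairs {k} p = allb (λ i → allb (λ j → p i j) (allFin k)) (allFin k)

isHom : (F G : Digraph) → (Fin (Digraph.size F) → Fin (Digraph.size G)) → Bool
isHom F G φ = forallPairs (λ i j → Digraph.edge F i j ⇒b Digraph.edge G (φ i) (φ j))

isInj : ∀ {k m} → (Fin k → Fin m) → Bool
isInj φ = forallPairs (λ i j → eqFin (φ i) (φ j) ⇒b eqFin i j)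

isInd : (F G : Digraph) → (Fin (Digraph.size F) → Fin (Digraph.size G)) → Bool
isInd F G φ = isInj φ ∧ forallPairs (λ i j → Digraph.edge F i j ⇔b Digraph.edge G (φ i) (φ j))

count : ∀ {A : Set} → (A → Bool) → List A → ℕ
count p []       = 0
count p (x ∷ xs) = if p x then suc (count p xs) else count p xs

frac : ℕ → ℕ → ℚ
frac a zero    = 0ℚ
frac a (suc d) = (+ a) / suc d

maps : (F G : Digraph) → List (Fin (Digraph.size F) → Fin (Digraph.size G))
maps F G = allMaps (Digraph.size F) (Digraph.size G)

t : Digraph → Digraph → ℚ
t F G = frac (count (isHom F G) (maps F G)) (length (maps F G))

-- proportion of injective maps that are homomorphisms (0 if there are no
-- injective maps, i.e. |F| > |G|)
tinj : Digraph → Digraph → ℚ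
tinj F G = frac (count (λ φ → isInj φ ∧ isHom F G φ) (maps F G)) (count isInj (maps F G))

tind : Digraph → Digraph → ℚ
tind F G = frac (count (isInd F G) (maps F G)) (count isInj (maps F G))

-- Convergence of a rational sequence (to a real limit) = Cauchy property.

Converges : (ℕ → ℚ) → Set
Converges a = ∀ (ε : ℚ) → 0ℚ <ℚ ε →
  ∃ λ N → ∀ m n → N ≤ m → N ≤ n → ∣ a m - a n ∣ <ℚ ε

-- ℕ ∪ {∞} as Maybe ℕ (nothing = ∞) and convergence there.
ℕ∞ : Set
ℕ∞ = Maybe ℕ

ConvergesToℕ∞ : (ℕ → ℕ) → ℕ∞ → Set
ConvergesToℕ∞ s (just L) = ∃ λ N → ∀ n → N ≤ n → s n ≡ L
ConvergesToℕ∞ s nothing  = ∀ k → ∃ λ N → ∀ n → N ≤ n → k ≤ s n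

ConvergesInℕ∞ : (ℕ → ℕ) → Set
ConvergesInℕ∞ s = Σ ℕ∞ (ConvergesToℕ∞ s)

module _ (P : ℕ → Poset) where
  Pd : ℕ → Digraph
  Pd n = toDigraph (P n)

  size∞ : Set
  size∞ = ConvergesInℕ∞ (λ n → Poset.size (P n))

  cond-i cond-ii cond-iii cond-iv cond-v cond-vi : Set
  cond-i   = (∀ (Q : Poset) → Converges (λ n → t (toDigraph Q) (Pd n))) × size∞
  cond-ii  = ∀ (Q : Poset) → Converges (λ n → tinj (toDigraph Q) (Pd n))
  cond-iii = ∀ (Q : Poset) → Converges (λ n → tind (toDigraph Q) (Pd n))
  cond-iv  = (∀ (F : Digraph) → Converges (λ n → t F (Pd n))) × size∞
  cond-v   = ∀ (F : Digraph) → Converges (λ n → tinj F (Pd n))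
  cond-vi  = ∀ (F : Digraph) → Converges (λ n → tind F (Pd n))

{-# OPTIONS --safe #-}
module Submission where

-- Expand each density into counts of maps satisfying lists of literals: "edge", "non-edge",
-- "distinct values".  Splitting a count along an edge and its negation is inclusion-exclusion
-- between injective and induced densities.  Splitting along φ i ≡ φ j, where the coincident maps
-- are the maps from a vertex set with one vertex less, relates homomorphism and injective counts:
-- exactly if |G| is eventually constant, and up to an error O(1/|G|) if |G| → ∞.  The size
-- converges since the injective density of the edgeless digraph on k vertices is 1 or 0 according
-- to k ≤ |G|.  For t and t_inj, the passage between posets and digraphs replaces an acyclic digraph
-- by its transitive closure; a digraph with a cycle has no homomorphism to a poset.

open import Defs
open import Axiom.ExcludedMiddle using (ExcludedMiddle)
open import Data.Bool using (Bool; true; false; _∧_; not; if_then_else_)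
import Data.Bool.Properties as Bool
open import Data.Fin as Fin using (Fin; zero; suc; punchOut)
import Data.Fin.Properties as Fin
open import Data.Integer as ℤ using (+_; -[1+_])
import Data.Integer.Properties as ℤ
import Data.Integer.Tactic.RingSolver as ℤSolver
open import Data.List using (List; []; _∷_; _++_; map; concatMap; length; allFin; filter; cartesianProduct)
import Data.List.Properties as List
open import Data.List.Membership.DecPropositional using () renaming (_∈?_ to member?)
open import Data.List.Membership.Propositional using (_∈_; _∉_; find; lose)
open import Data.List.Membership.Propositional.Properties using (∈-allFin; ∈-map⁺; ∈-map⁻; ∈-filter⁺; ∈-filter⁻; ∈-cartesianProduct⁺; ∈-++⁺ˡ; ∈-++⁺ʳ; ∈-++⁻; ∈-concatMap⁺)
open import Data.List.Relation.Binary.Permutation.Propositional using (_↭_; ↭-sym)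
open import Data.List.Relation.Binary.Permutation.Propositional.Properties using (shift; ++-comm)
open import Data.List.Relation.Binary.Subset.Propositional using (_⊆_)
open import Data.List.Relation.Binary.Subset.Propositional.Properties using (⊆-reflexive-↭; ++⁺; map⁺; ⊆-trans; ⊆-refl)
open import Data.List.Relation.Unary.Any using (here; there; any?)
open import Data.Maybe using (just; nothing)
open import Data.Nat as ℕ using (ℕ; zero; suc; _+_; _*_; _∸_; _⊔_; _≤_; _<_; z≤n; s≤s)
import Data.Nat.Properties as ℕ
open import Data.Nat.Tactic.RingSolver using (solve-∀)
open import Data.Product as Product using (∃; _×_; _,_; proj₁; proj₂)
open import Data.Product.Properties using (≡-dec)
open import Data.Rational as ℚ using (ℚ; 0ℚ; ½; ∣_∣; toℚᵘ; fromℚᵘ)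
import Data.Rational.Properties as ℚ
open import Data.Rational.Solver using (module +-*-Solver)
open import Data.Rational.Unnormalised as ℚᵘ using (mkℚᵘ; *≡*; *≤*; *<*)
import Data.Rational.Unnormalised.Properties as ℚᵘ
open import Data.Sum using (_⊎_; inj₁; inj₂; [_,_]′)
open import Function using (_∘_; id)
open import Function.Bundles using (_⇔_; mk⇔)
open import Level using (0ℓ)
open import Relation.Binary.Construct.Closure.Transitive using (TransClosure; [_]; _∷_) renaming (_++_ to _++ᵀ_)
open import Relation.Binary.Definitions using (tri<; tri≈; tri>)
open import Relation.Binary.PropositionalEquality
open import Relation.Nullary using (Dec; ¬_; yes; no; ¬?; does; contradiction)
open import Relation.Nullary.Decidable using (dec-true; dec-false)
open Digraph using (size; edge)

-- Convergence of rational sequences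

-- The decompositions leave the class of posets: deleting a relation, or identifying two vertices,
-- need not give a poset again. So each poset condition is first widened to all digraphs, and all
-- implications meet at (v). For induced densities this widening involves no closure: a digraph that
-- is not a strict order has no induced copy in a poset at all.
--
-- The delicate case is that of eventually constant size. Identifying vertices changes the vertex
-- number, hence the denominator, and an injective density may have denominator 0, so the recursion
-- is not one between densities. But all denominators are then eventually constant, and convergence
-- of the quotients forces the integer numerators to be eventually constant. Such numerators can be
-- added and subtracted across different vertex numbers.
--
-- Excluded middle decides whether the sizes stabilise, whether a digraph has a cycle or is a strict
-- order, and which pairs of vertices are joined by a path.

frac-+ : ∀ a b d → frac (a + b) d ≡ frac a d ℚ.+ frac b d
frac-+ a b zero = refl
frac-+ a b (suc d) = ℚ.toℚᵘ-injective (begin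
  toℚᵘ (fromℚᵘ (mkℚᵘ (+ (a + b)) d))                            ≈⟨ ℚ.toℚᵘ-fromℚᵘ _ ⟩
  mkℚᵘ (+ (a + b)) d                                            ≈⟨ *≡* (cross (+ a) (+ b) (+ suc d)) ⟩
  mkℚᵘ (+ a) d ℚᵘ.+ mkℚᵘ (+ b) d                                ≈⟨ ℚᵘ.+-cong (ℚ.toℚᵘ-fromℚᵘ (mkℚᵘ (+ a) d)) (ℚ.toℚᵘ-fromℚᵘ (mkℚᵘ (+ b) d)) ⟨
  toℚᵘ (fromℚᵘ (mkℚᵘ (+ a) d)) ℚᵘ.+ toℚᵘ (fromℚᵘ (mkℚᵘ (+ b) d)) ≈⟨ ℚ.toℚᵘ-homo-+ (frac a (suc d)) (frac b (suc d)) ⟨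
  toℚᵘ (frac a (suc d) ℚ.+ frac b (suc d))                      ∎)
  where
  open ℚᵘ.≃-Reasoning
  cross : ∀ a b d → (a ℤ.+ b) ℤ.* (d ℤ.* d) ≡ (a ℤ.* d ℤ.+ b ℤ.* d) ℤ.* d
  cross = ℤSolver.solve-∀

frac-mono : ∀ {a b} d e → a * suc e ≤ b * suc d → frac a (suc d) ℚ.≤ frac b (suc e)
frac-mono {a} {b} d e le = ℚ.toℚᵘ-cancel-≤ (begin
  toℚᵘ (fromℚᵘ (mkℚᵘ (+ a) d)) ≃⟨ ℚ.toℚᵘ-fromℚᵘ (mkℚᵘ (+ a) d) ⟩
  mkℚᵘ (+ a) d                 ≤⟨ *≤* (subst₂ ℤ._≤_ (ℤ.pos-* a (suc e)) (ℤ.pos-* b (suc d)) (ℤ.+≤+ le)) ⟩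
  mkℚᵘ (+ b) e                 ≃⟨ ℚ.toℚᵘ-fromℚᵘ (mkℚᵘ (+ b) e) ⟨
  toℚᵘ (fromℚᵘ (mkℚᵘ (+ b) e)) ∎)
  where open ℚᵘ.≤-Reasoning

frac-≤-+ : ∀ a d b e c f → a * (suc e * suc f) ≤ (b * suc f + c * suc e) * suc d →
  frac a (suc d) ℚ.≤ frac b (suc e) ℚ.+ frac c (suc f)
frac-≤-+ a d b e c f le = ℚ.toℚᵘ-cancel-≤ (begin
  toℚᵘ (fromℚᵘ (mkℚᵘ (+ a) d))                                  ≃⟨ ℚ.toℚᵘ-fromℚᵘ (mkℚᵘ (+ a) d) ⟩
  mkℚᵘ (+ a) d                                                  ≤⟨ *≤* (subst₂ ℤ._≤_ (ℤ.pos-* a (suc e * suc f)) rhs (ℤ.+≤+ le)) ⟩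
  mkℚᵘ (+ b) e ℚᵘ.+ mkℚᵘ (+ c) f                                ≃⟨ ℚᵘ.+-cong (ℚ.toℚᵘ-fromℚᵘ (mkℚᵘ (+ b) e)) (ℚ.toℚᵘ-fromℚᵘ (mkℚᵘ (+ c) f)) ⟨
  toℚᵘ (fromℚᵘ (mkℚᵘ (+ b) e)) ℚᵘ.+ toℚᵘ (fromℚᵘ (mkℚᵘ (+ c) f)) ≃⟨ ℚ.toℚᵘ-homo-+ (frac b (suc e)) (frac c (suc f)) ⟨
  toℚᵘ (frac b (suc e) ℚ.+ frac c (suc f))                      ∎)
  where
  open ℚᵘ.≤-Reasoning
  rhs : + ((b * suc f + c * suc e) * suc d) ≡ (+ b ℤ.* + suc f ℤ.+ + c ℤ.* + suc e) ℤ.* + suc d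
  rhs = trans (ℤ.pos-* (b * suc f + c * suc e) (suc d))
    (cong (ℤ._* + suc d) (cong₂ ℤ._+_ (ℤ.pos-* b (suc f)) (ℤ.pos-* c (suc e))))

frac-small : ∀ C {ε} → 0ℚ ℚ.< ε → ∃ λ K → ∀ N → K ≤ N → frac C N ℚ.< ε
frac-small C {ℚ.mkℚ (+ zero) q _} (ℚ.*<* (ℤ.+<+ ()))
frac-small C {ℚ.mkℚ -[1+ _ ] q _} (ℚ.*<* ())
-- Here ε = (p+1)/(q+1) ≥ 1/(q+1), so every N > C(q+1) gives C/N < ε.
frac-small C {ε@(ℚ.mkℚ (+ suc p) q _)} ε>0 = suc (C * suc q) , small
  where
  open ℚᵘ.≤-Reasoning
  small : ∀ N → suc (C * suc q) ≤ N → frac C N ℚ.< ε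
  small (suc N) (s≤s le) = ℚ.toℚᵘ-cancel-< (begin-strict
    toℚᵘ (fromℚᵘ (mkℚᵘ (+ C) N)) ≃⟨ ℚ.toℚᵘ-fromℚᵘ (mkℚᵘ (+ C) N) ⟩
    mkℚᵘ (+ C) N                 <⟨ *<* (subst (ℤ._< + suc p ℤ.* + suc N) (ℤ.pos-* C (suc q)) (ℤ.+<+ (s≤s (ℕ.≤-trans le (ℕ.m≤m+n N _))))) ⟩
    mkℚᵘ (+ suc p) q             ∎)

p+q-p≡q : ∀ p q → (p ℚ.+ q) ℚ.- p ≡ q
p+q-p≡q = solve 2 (λ p q → (p :+ q) :- p := q) refl where open +-*-Solver

p-q≡-[q-p] : ∀ p q → p ℚ.- q ≡ ℚ.- (q ℚ.- p)
p-q≡-[q-p] = solve 2 (λ p q → p :- q := :- (q :- p)) refl where open +-*-Solver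

∣p-q∣≡∣q-p∣ : ∀ p q → ∣ p ℚ.- q ∣ ≡ ∣ q ℚ.- p ∣
∣p-q∣≡∣q-p∣ p q = trans (cong ∣_∣ (p-q≡-[q-p] p q)) (ℚ.∣-p∣≡∣p∣ (q ℚ.- p))

∣p-q∣≤r : ∀ {p q r} → p ℚ.≤ q ℚ.+ r → q ℚ.≤ p ℚ.+ r → ∣ p ℚ.- q ∣ ℚ.≤ r
∣p-q∣≤r {p} {q} {r} p≤q+r q≤p+r with ℚ.∣p∣≡p∨∣p∣≡-p (p ℚ.- q)
... | inj₁ eq = subst₂ ℚ._≤_ (sym eq) (p+q-p≡q q r) (ℚ.+-monoˡ-≤ (ℚ.- q) p≤q+r)
... | inj₂ eq = subst₂ ℚ._≤_ (trans (p-q≡-[q-p] q p) (sym eq)) (p+q-p≡q p r) (ℚ.+-monoˡ-≤ (ℚ.- p) q≤p+r)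

frac-gap : ∀ {a b} d → a < b → frac 1 (suc d) ℚ.≤ ∣ frac a (suc d) ℚ.- frac b (suc d) ∣
frac-gap {a} {b} d a<b = begin
  frac 1 (suc d)                                       ≡⟨ p+q-p≡q (frac a (suc d)) (frac 1 (suc d)) ⟨
  (frac a (suc d) ℚ.+ frac 1 (suc d)) ℚ.- frac a (suc d) ≡⟨ cong (ℚ._- frac a (suc d)) (trans (cong (λ x → frac x (suc d)) (ℕ.+-comm 1 a)) (frac-+ a 1 (suc d))) ⟨
  frac (suc a) (suc d) ℚ.- frac a (suc d)              ≤⟨ ℚ.+-monoˡ-≤ (ℚ.- frac a (suc d)) (frac-mono {suc a} {b} d d (ℕ.*-monoˡ-≤ (suc d) a<b)) ⟩
  frac b (suc d) ℚ.- frac a (suc d)                    ≤⟨ p≤∣p∣ (frac b (suc d) ℚ.- frac a (suc d)) ⟩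
  ∣ frac b (suc d) ℚ.- frac a (suc d) ∣                ≡⟨ ∣p-q∣≡∣q-p∣ (frac b (suc d)) (frac a (suc d)) ⟩
  ∣ frac a (suc d) ℚ.- frac b (suc d) ∣                ∎
  where
  open ℚ.≤-Reasoning
  p≤∣p∣ : ∀ p → p ℚ.≤ ∣ p ∣
  p≤∣p∣ p with ℚ.≤-total 0ℚ p
  ... | inj₁ 0≤p = ℚ.≤-reflexive (sym (ℚ.0≤p⇒∣p∣≡p 0≤p))
  ... | inj₂ p≤0 = ℚ.≤-trans p≤0 (ℚ.0≤∣p∣ p)

frac-close⇒≡ : ∀ {a b} d → ∣ frac a (suc d) ℚ.- frac b (suc d) ∣ ℚ.< frac 1 (suc d) → a ≡ b
frac-close⇒≡ {a} {b} d close with ℕ.<-cmp a b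
... | tri≈ _ a≡b _ = a≡b
... | tri< a<b _ _ = contradiction (ℚ.≤-<-trans (frac-gap d a<b) close) (ℚ.<-irrefl refl)
... | tri> _ _ b<a = contradiction (ℚ.≤-<-trans (frac-gap d b<a) (subst (ℚ._< _) (∣p-q∣≡∣q-p∣ (frac a (suc d)) (frac b (suc d))) close)) (ℚ.<-irrefl refl)

frac-0 : ∀ {a} d → a ≡ 0 → frac a d ≡ 0ℚ
frac-0 zero    refl = refl
frac-0 (suc d) refl = ℚ.0/n≡0 (suc d)

-- The value of d/d under the convention `frac 0 0 = 0`. Writing it over the fixed denominator 1
-- makes `Converges⇒EC` applicable to the densities of edgeless digraphs.
sg : ℕ → ℕ
sg zero    = 0
sg (suc _) = 1

sg≤1 : ∀ n → sg n ≤ 1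
sg≤1 zero    = z≤n
sg≤1 (suc _) = s≤s z≤n

sg-transfer : ∀ {m n} → sg m ≡ sg n → 1 ≤ m → 1 ≤ n
sg-transfer {suc m} {suc n} _ _ = s≤s z≤n

frac-self : ∀ d → frac d d ≡ frac (sg d) 1
frac-self zero    = refl
frac-self (suc d) = ℚ.≤-antisym (frac-mono {suc d} {1} d 0 (ℕ.≤-reflexive (ℕ.*-comm (suc d) 1)))
                                (frac-mono {1} {suc d} 0 d (ℕ.≤-reflexive (ℕ.*-comm 1 (suc d))))

0<frac1 : ∀ d → 0ℚ ℚ.< frac 1 (suc d)
0<frac1 d = ℚ.positive⁻¹ (frac 1 (suc d)) ⦃ ℚ.normalize-pos 1 (suc d) ⦄

-- To be read with H homomorphisms and J injective ones, among T maps of which I are injective.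
-- Non-injective homomorphisms are non-injective maps, so H - J ≤ T - I ≤ (C/N)T. Hence H/T ≤ J/T +
-- C/N ≤ J/I + C/N. Conversely J/I - J/T = (J/I)(T - I)/T ≤ C/N because J ≤ I, and J/T ≤ H/T.
frac-dist : ∀ H J T I N C → 1 ≤ T → 1 ≤ I → 1 ≤ N → J ≤ H → J ≤ I → I ≤ T →
  H + I ≤ J + T → N * T ≤ N * I + C * T → ∣ frac H T ℚ.- frac J I ∣ ℚ.≤ frac C N
frac-dist H J T@(suc t) I@(suc i) N@(suc n) C _ _ _ J≤H J≤I I≤T H+I≤J+T NT≤NI+CT =
  ∣p-q∣≤r (frac-≤-+ H t J i C n upper) (frac-≤-+ J i H t C n lower)
  where
  open ℕ.≤-Reasoning
  NH≤NJ+CT : N * H ≤ N * J + C * T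
  NH≤NJ+CT = ℕ.+-cancelʳ-≤ (N * I) _ _ (begin
    N * H + N * I             ≡⟨ ℕ.*-distribˡ-+ N H I ⟨
    N * (H + I)               ≤⟨ ℕ.*-monoʳ-≤ N H+I≤J+T ⟩
    N * (J + T)               ≡⟨ ℕ.*-distribˡ-+ N J T ⟩
    N * J + N * T             ≤⟨ ℕ.+-monoʳ-≤ (N * J) NT≤NI+CT ⟩
    N * J + (N * I + C * T)   ≡⟨ assoc-comm (N * J) (N * I) (C * T) ⟩
    (N * J + C * T) + N * I   ∎)
    where
    assoc-comm : ∀ a b c → a + (b + c) ≡ (a + c) + b
    assoc-comm = solve-∀
  upper : H * (I * N) ≤ (J * N + C * I) * T
  upper = begin
    H * (I * N)                ≡⟨ e₁ H I N ⟩
    N * H * I                  ≤⟨ ℕ.*-monoˡ-≤ I NH≤NJ+CT ⟩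
    (N * J + C * T) * I        ≡⟨ e₂ N J C T I ⟩
    J * N * I + C * I * T      ≤⟨ ℕ.+-monoˡ-≤ (C * I * T) (ℕ.*-monoʳ-≤ (J * N) I≤T) ⟩
    J * N * T + C * I * T      ≡⟨ ℕ.*-distribʳ-+ T (J * N) (C * I) ⟨
    (J * N + C * I) * T        ∎
    where
    e₁ : ∀ h i n → h * (i * n) ≡ n * h * i
    e₁ = solve-∀
    e₂ : ∀ n j c t i → (n * j + c * t) * i ≡ j * n * i + c * i * t
    e₂ = solve-∀
  lower : J * (T * N) ≤ (H * N + C * T) * I
  lower = begin
    J * (T * N)                ≡⟨ cong (J *_) (ℕ.*-comm T N) ⟩
    J * (N * T)                ≤⟨ ℕ.*-monoʳ-≤ J NT≤NI+CT ⟩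
    J * (N * I + C * T)        ≡⟨ ℕ.*-distribˡ-+ J (N * I) (C * T) ⟩
    J * (N * I) + J * (C * T)  ≤⟨ ℕ.+-mono-≤ (ℕ.*-monoˡ-≤ (N * I) J≤H) (ℕ.*-monoˡ-≤ (C * T) J≤I) ⟩
    H * (N * I) + I * (C * T)  ≡⟨ e₃ H N I C T ⟩
    (H * N + C * T) * I        ∎
    where
    e₃ : ∀ h n i c t → h * (n * i) + i * (c * t) ≡ (h * n + c * t) * i
    e₃ = solve-∀

Converges-cong : ∀ {a b} → (∀ n → a n ≡ b n) → Converges a → Converges b
Converges-cong a≡b ca ε ε>0 with ca ε ε>0
... | M , close = M , λ m n M≤m M≤n →
  subst₂ (λ p q → ∣ p ℚ.- q ∣ ℚ.< ε) (a≡b m) (a≡b n) (close m n M≤m M≤n)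

Converges-const : ∀ c → Converges (λ _ → c)
Converges-const c ε ε>0 = 0 , λ _ _ _ _ → subst (ℚ._< ε) (cong ∣_∣ (sym (ℚ.+-inverseʳ c))) ε>0

½*-pos : ∀ {ε} → 0ℚ ℚ.< ε → 0ℚ ℚ.< ½ ℚ.* ε
½*-pos {ε} ε>0 = ℚ.positive⁻¹ (½ ℚ.* ε) ⦃ ℚ.pos*pos⇒pos ½ ε ⦃ ℚ.positive ε>0 ⦄ ⦄

½+½ : ∀ ε → ½ ℚ.* ε ℚ.+ ½ ℚ.* ε ≡ ε
½+½ ε = trans (sym (ℚ.*-distribʳ-+ ε ½ ½)) (ℚ.*-identityˡ ε)

Converges-+ : ∀ {a b} → Converges a → Converges b → Converges (λ n → a n ℚ.+ b n)
Converges-+ {a} {b} ca cb ε ε>0 with ca (½ ℚ.* ε) (½*-pos ε>0) | cb (½ ℚ.* ε) (½*-pos ε>0)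
... | M , closeᵃ | M′ , closeᵇ = M ⊔ M′ , λ m n le le′ → begin-strict
  ∣ (a m ℚ.+ b m) ℚ.- (a n ℚ.+ b n) ∣         ≡⟨ cong ∣_∣ (swap (a m) (b m) (a n) (b n)) ⟩
  ∣ (a m ℚ.- a n) ℚ.+ (b m ℚ.- b n) ∣         ≤⟨ ℚ.∣p+q∣≤∣p∣+∣q∣ (a m ℚ.- a n) (b m ℚ.- b n) ⟩
  ∣ a m ℚ.- a n ∣ ℚ.+ ∣ b m ℚ.- b n ∣         <⟨ ℚ.+-mono-< (closeᵃ m n (ℕ.m⊔n≤o⇒m≤o M M′ le) (ℕ.m⊔n≤o⇒m≤o M M′ le′))
                                                            (closeᵇ m n (ℕ.m⊔n≤o⇒n≤o M M′ le) (ℕ.m⊔n≤o⇒n≤o M M′ le′)) ⟩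
  ½ ℚ.* ε ℚ.+ ½ ℚ.* ε                         ≡⟨ ½+½ ε ⟩
  ε                                           ∎
  where
  open ℚ.≤-Reasoning
  swap : ∀ p q r s → (p ℚ.+ q) ℚ.- (r ℚ.+ s) ≡ (p ℚ.- r) ℚ.+ (q ℚ.- s)
  swap = solve 4 (λ p q r s → (p :+ q) :- (r :+ s) := (p :- r) :+ (q :- s)) refl where open +-*-Solver

Converges-neg : ∀ {a} → Converges a → Converges (λ n → ℚ.- a n)
Converges-neg {a} ca ε ε>0 with ca ε ε>0
... | M , close = M , λ m n M≤m M≤n → subst (ℚ._< ε) (flip (a m) (a n)) (close m n M≤m M≤n)
  where
  flip : ∀ p q → ∣ p ℚ.- q ∣ ≡ ∣ (ℚ.- p) ℚ.- (ℚ.- q) ∣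
  flip p q = trans (sym (ℚ.∣-p∣≡∣p∣ (p ℚ.- q))) (cong ∣_∣ (ℚ.neg-distrib-+ p (ℚ.- q)))

Converges-∸ : ∀ {a b c} → (∀ n → a n ≡ b n ℚ.+ c n) → Converges a → Converges c → Converges b
Converges-∸ {a} {b} {c} a≡b+c ca cc =
  Converges-cong (λ n → trans (cong (ℚ._- c n) (trans (a≡b+c n) (ℚ.+-comm (b n) (c n)))) (p+q-p≡q (c n) (b n))) (Converges-+ {a} {λ n → ℚ.- c n} ca (Converges-neg {c} cc))

Converges-close : ∀ {a b} → (∀ ε → 0ℚ ℚ.< ε → ∃ λ M → ∀ n → M ≤ n → ∣ a n ℚ.- b n ∣ ℚ.< ε) →
  Converges a → Converges b
Converges-close {a} {b} near ca = Converges-∸ {a} {b} {λ n → a n ℚ.- b n} (λ n → sym (split (a n) (b n))) ca null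
  where
  split : ∀ p q → q ℚ.+ (p ℚ.- q) ≡ p
  split = solve 2 (λ p q → q :+ (p :- q) := p) refl where open +-*-Solver
  null : Converges (λ n → a n ℚ.- b n)
  null ε ε>0 with near (½ ℚ.* ε) (½*-pos ε>0)
  ... | M , small = M , λ m n M≤m M≤n → begin-strict
    ∣ (a m ℚ.- b m) ℚ.- (a n ℚ.- b n) ∣       ≤⟨ ℚ.∣p-q∣≤∣p∣+∣q∣ (a m ℚ.- b m) (a n ℚ.- b n) ⟩
    ∣ a m ℚ.- b m ∣ ℚ.+ ∣ a n ℚ.- b n ∣       <⟨ ℚ.+-mono-< (small m M≤m) (small n M≤n) ⟩
    ½ ℚ.* ε ℚ.+ ½ ℚ.* ε                       ≡⟨ ½+½ ε ⟩
    ε                                         ∎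
    where open ℚ.≤-Reasoning

-- The form that convergence takes for integer counts. Unlike convergence of densities it refers to
-- no denominator, so it passes through any operation on counts that belong to different vertex
-- numbers.
EventuallyConstant : (ℕ → ℕ) → Set
EventuallyConstant a = ∃ λ M → ∀ m n → M ≤ m → M ≤ n → a m ≡ a n

EC-cong : ∀ {a b} → (∀ n → a n ≡ b n) → EventuallyConstant a → EventuallyConstant b
EC-cong a≡b (M , const) = M , λ m n M≤m M≤n → trans (sym (a≡b m)) (trans (const m n M≤m M≤n) (a≡b n))

EC-map₂ : ∀ {a b} (f : ℕ → ℕ → ℕ) → EventuallyConstant a → EventuallyConstant b → EventuallyConstant (λ n → f (a n) (b n))
EC-map₂ f (M , constᵃ) (M′ , constᵇ) = M ⊔ M′ , λ m n le le′ → cong₂ f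
  (constᵃ m n (ℕ.m⊔n≤o⇒m≤o M M′ le) (ℕ.m⊔n≤o⇒m≤o M M′ le′))
  (constᵇ m n (ℕ.m⊔n≤o⇒n≤o M M′ le) (ℕ.m⊔n≤o⇒n≤o M M′ le′))

EC⇒Converges : ∀ {a d} → EventuallyConstant d → EventuallyConstant a → Converges (λ n → frac (a n) (d n))
EC⇒Converges {a} {d} (M , constᵈ) (M′ , constᵃ) ε ε>0 = M ⊔ M′ , λ m n le le′ →
  subst (ℚ._< ε) (cong ∣_∣ (sym (trans
    (cong (ℚ._- frac (a n) (d n)) (cong₂ frac
      (constᵃ m n (ℕ.m⊔n≤o⇒n≤o M M′ le) (ℕ.m⊔n≤o⇒n≤o M M′ le′))
      (constᵈ m n (ℕ.m⊔n≤o⇒m≤o M M′ le) (ℕ.m⊔n≤o⇒m≤o M M′ le′))))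
    (ℚ.+-inverseʳ (frac (a n) (d n)))))) ε>0

-- Once the denominator is a constant D > 0, distinct quotients differ by at least 1/D, so ε = 1/D
-- forces equal numerators. For D = 0 the quotient carries no information, and `a n ≤ d n` gives a =
-- 0 instead.
Converges⇒EC : ∀ {a d} → EventuallyConstant d → (∀ n → a n ≤ d n) →
  Converges (λ n → frac (a n) (d n)) → EventuallyConstant a
Converges⇒EC {a} {d} (M , constᵈ) a≤d ca = go (d M) (λ n M≤n → constᵈ n M M≤n ℕ.≤-refl)
  where
  go : ∀ D → (∀ n → M ≤ n → d n ≡ D) → EventuallyConstant a
  go zero    d≡0 = M , λ m n M≤m M≤n →
    trans (ℕ.n≤0⇒n≡0 (subst (a m ≤_) (d≡0 m M≤m) (a≤d m))) (sym (ℕ.n≤0⇒n≡0 (subst (a n ≤_) (d≡0 n M≤n) (a≤d n))))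
  go (suc D) d≡D with ca (frac 1 (suc D)) (0<frac1 D)
  ... | M′ , close = M ⊔ M′ , λ m n le le′ → frac-close⇒≡ D
    (subst₂ (λ x y → ∣ frac (a m) x ℚ.- frac (a n) y ∣ ℚ.< frac 1 (suc D))
      (d≡D m (ℕ.m⊔n≤o⇒m≤o M M′ le)) (d≡D n (ℕ.m⊔n≤o⇒m≤o M M′ le′))
      (close m n (ℕ.m⊔n≤o⇒n≤o M M′ le) (ℕ.m⊔n≤o⇒n≤o M M′ le′)))

-- Counting maps

module _ {A : Set} where

  count-mono : ∀ {p q : A → Bool} xs → (∀ x → p x ≡ true → q x ≡ true) → count p xs ≤ count q xs
  count-mono []       p⇒q = z≤n
  count-mono {p} {q} (x ∷ xs) p⇒q with p x in px | q x in qx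
  ... | true  | true  = s≤s (count-mono xs p⇒q)
  ... | true  | false = contradiction (trans (sym (p⇒q x px)) qx) λ ()
  ... | false | true  = ℕ.m≤n⇒m≤1+n (count-mono xs p⇒q)
  ... | false | false = count-mono xs p⇒q

  count-cong : ∀ {p q : A → Bool} xs → (∀ x → p x ≡ true → q x ≡ true) →
    (∀ x → q x ≡ true → p x ≡ true) → count p xs ≡ count q xs
  count-cong xs p⇒q q⇒p = ℕ.≤-antisym (count-mono xs p⇒q) (count-mono xs q⇒p)

  count-false : ∀ {p : A → Bool} xs → (∀ x → p x ≡ false) → count p xs ≡ 0
  count-false []       p≡f = refl
  count-false (x ∷ xs) p≡f rewrite p≡f x = count-false xs p≡f

  count-true : ∀ (xs : List A) → count (λ _ → true) xs ≡ length xs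
  count-true []       = refl
  count-true (x ∷ xs) = cong suc (count-true xs)

  count-split : ∀ (p q : A → Bool) xs →
    count p xs ≡ count (λ x → q x ∧ p x) xs + count (λ x → not (q x) ∧ p x) xs
  count-split p q []       = refl
  count-split p q (x ∷ xs) with q x | p x
  ... | true  | true  = cong suc (count-split p q xs)
  ... | true  | false = count-split p q xs
  ... | false | true  = trans (cong suc (count-split p q xs)) (sym (ℕ.+-suc _ _))
  ... | false | false = count-split p q xs

  -- The elements satisfying p but not q are among those failing q, written without subtraction. It
  -- supplies the inequality H + I ≤ J + T of `frac-dist`.
  count-∧-∨ : ∀ (p q : A → Bool) xs →
    count p xs + count q xs ≤ count (λ x → p x ∧ q x) xs + length xs
  count-∧-∨ p q []       = z≤n
  count-∧-∨ p q (x ∷ xs) with p x | q x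
  ... | true  | true  = s≤s (subst₂ _≤_ (sym (ℕ.+-suc _ _)) (sym (ℕ.+-suc _ _)) (s≤s (count-∧-∨ p q xs)))
  ... | true  | false = subst (suc (count p xs + count q xs) ≤_) (sym (ℕ.+-suc _ _)) (s≤s (count-∧-∨ p q xs))
  ... | false | true  = subst₂ _≤_ (sym (ℕ.+-suc _ _)) (sym (ℕ.+-suc _ _)) (s≤s (count-∧-∨ p q xs))
  ... | false | false = subst (count p xs + count q xs ≤_) (sym (ℕ.+-suc _ _)) (ℕ.m≤n⇒m≤1+n (count-∧-∨ p q xs))

  ∑ : (A → ℕ) → List A → ℕ
  ∑ f []       = 0
  ∑ f (x ∷ xs) = f x + ∑ f xs

  ∑-cong : ∀ {f g : A → ℕ} xs → (∀ x → f x ≡ g x) → ∑ f xs ≡ ∑ g xs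
  ∑-cong []       f≡g = refl
  ∑-cong (x ∷ xs) f≡g = cong₂ _+_ (f≡g x) (∑-cong xs f≡g)

  ∑-++ : ∀ (f : A → ℕ) xs ys → ∑ f (xs ++ ys) ≡ ∑ f xs + ∑ f ys
  ∑-++ f []       ys = refl
  ∑-++ f (x ∷ xs) ys = trans (cong (f x ℕ.+_) (∑-++ f xs ys)) (sym (ℕ.+-assoc (f x) _ _))

  ∑-+ : ∀ (f g : A → ℕ) xs → ∑ (λ x → f x + g x) xs ≡ ∑ f xs + ∑ g xs
  ∑-+ f g []       = refl
  ∑-+ f g (x ∷ xs) = trans (cong (f x + g x ℕ.+_) (∑-+ f g xs)) (interchange (f x) (g x) _ _)
    where
    interchange : ∀ a b c d → (a + b) + (c + d) ≡ (a + c) + (b + d)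
    interchange = solve-∀

  ∑-0 : ∀ (xs : List A) → ∑ (λ _ → 0) xs ≡ 0
  ∑-0 []       = refl
  ∑-0 (_ ∷ xs) = ∑-0 xs

  ∑-const : ∀ c (xs : List A) → ∑ (λ _ → c) xs ≡ length xs * c
  ∑-const c []       = refl
  ∑-const c (_ ∷ xs) = cong (c ℕ.+_) (∑-const c xs)

bit : Bool → ℕ
bit b = if b then 1 else 0

bit-∧ : ∀ a b → bit (a ∧ b) ≡ bit a * bit b
bit-∧ true  b = sym (ℕ.+-identityʳ (bit b))
bit-∧ false b = refl

count≡∑ : ∀ {A : Set} (p : A → Bool) xs → count p xs ≡ ∑ (bit ∘ p) xs
count≡∑ p []       = refl
count≡∑ p (x ∷ xs) with p x
... | true  = cong suc (count≡∑ p xs)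
... | false = count≡∑ p xs

∑-swap : ∀ {A B : Set} (f : A → B → ℕ) xs ys →
  ∑ (λ x → ∑ (f x) ys) xs ≡ ∑ (λ y → ∑ (λ x → f x y) xs) ys
∑-swap f []       ys = sym (∑-0 ys)
∑-swap f (x ∷ xs) ys = trans (cong (∑ (f x) ys ℕ.+_) (∑-swap f xs ys)) (sym (∑-+ (f x) _ ys))

∑-map : ∀ {A B : Set} (f : B → ℕ) (g : A → B) xs → ∑ f (map g xs) ≡ ∑ (f ∘ g) xs
∑-map f g []       = refl
∑-map f g (x ∷ xs) = cong (f (g x) ℕ.+_) (∑-map f g xs)

∑-concatMap : ∀ {A B : Set} (f : B → ℕ) (g : A → List B) xs →
  ∑ f (concatMap g xs) ≡ ∑ (λ x → ∑ f (g x)) xs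
∑-concatMap f g []       = refl
∑-concatMap f g (x ∷ xs) = trans (∑-++ f (g x) (concatMap g xs)) (cong (∑ f (g x) ℕ.+_) (∑-concatMap f g xs))

∑-allFin-suc : ∀ {n} (f : Fin (suc n) → ℕ) → ∑ f (allFin (suc n)) ≡ f zero + ∑ (f ∘ suc) (allFin n)
∑-allFin-suc {n} f = cong (f zero ℕ.+_) (trans (cong (∑ f) (sym (List.map-tabulate id suc))) (∑-map f suc (allFin n)))

eqFin⇒≡ : ∀ {m} {a b : Fin m} → eqFin a b ≡ true → a ≡ b
eqFin⇒≡ {a = a} {b} eq with a Fin.≟ b
... | yes a≡b = a≡b

≡⇒eqFin : ∀ {m} {a b : Fin m} → a ≡ b → eqFin a b ≡ true
≡⇒eqFin {a = a} {b} a≡b with a Fin.≟ b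
... | yes _  = refl
... | no a≢b = contradiction a≡b a≢b

eqFin-suc : ∀ {m} (a b : Fin m) → eqFin (suc a) (suc b) ≡ eqFin a b
eqFin-suc a b with a Fin.≟ b
... | yes _ = refl
... | no _  = refl

∑-eqFin : ∀ {m} (f : Fin m → ℕ) b → ∑ (λ a → bit (eqFin b a) * f a) (allFin m) ≡ f b
∑-eqFin {suc m} f zero = begin
  ∑ (λ a → bit (eqFin zero a) * f a) (allFin (suc m)) ≡⟨ ∑-allFin-suc (λ a → bit (eqFin zero a) * f a) ⟩
  1 * f zero + ∑ (λ _ → 0) (allFin m)                  ≡⟨ cong₂ _+_ (ℕ.*-identityˡ (f zero)) (∑-0 (allFin m)) ⟩
  f zero + 0                                           ≡⟨ ℕ.+-identityʳ (f zero) ⟩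
  f zero                                               ∎
  where open ≡-Reasoning
∑-eqFin {suc m} f (suc b) = begin
  ∑ (λ a → bit (eqFin (suc b) a) * f a) (allFin (suc m))  ≡⟨ ∑-allFin-suc (λ a → bit (eqFin (suc b) a) * f a) ⟩
  ∑ (λ a → bit (eqFin (suc b) (suc a)) * f (suc a)) (allFin m) ≡⟨ ∑-cong (allFin m) (λ a → cong (λ e → bit e * f (suc a)) (eqFin-suc b a)) ⟩
  ∑ (λ a → bit (eqFin b a) * f (suc a)) (allFin m)        ≡⟨ ∑-eqFin (f ∘ suc) b ⟩
  f (suc b)                                               ∎
  where open ≡-Reasoning

-- `allMaps` enumerates by the value at `zero`; this is `extend` with the new point at an arbitrary
-- position j, so that the value at any vertex can be singled out.
insert : ∀ {k m} → Fin (suc k) → Fin m → (Fin k → Fin m) → Fin (suc k) → Fin m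
insert         zero    a ψ = extend a ψ
insert {suc k} (suc j) a ψ = extend (ψ zero) (insert j a (ψ ∘ suc))

insert-at : ∀ {k m} j (a : Fin m) (ψ : Fin k → Fin m) → insert j a ψ j ≡ a
insert-at         zero    a ψ = refl
insert-at {suc k} (suc j) a ψ = insert-at j a (ψ ∘ suc)

insert-punchOut : ∀ {k m} {j i : Fin (suc k)} (j≢i : j ≢ i) (a : Fin m) (ψ : Fin k → Fin m) →
  insert j a ψ i ≡ ψ (punchOut j≢i)
insert-punchOut {j = zero}          {zero}  j≢i a ψ = contradiction refl j≢i
insert-punchOut {j = zero}          {suc i} j≢i a ψ = refl
insert-punchOut {suc k} {j = suc j} {zero}  j≢i a ψ = refl
insert-punchOut {suc k} {j = suc j} {suc i} j≢i a ψ = insert-punchOut (j≢i ∘ cong suc) a (ψ ∘ suc)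

insert-∘ : ∀ {k l m} j a (ψ : Fin k → Fin l) (g : Fin l → Fin m) x →
  insert j (g a) (g ∘ ψ) x ≡ g (insert j a ψ x)
insert-∘         zero    a ψ g zero    = refl
insert-∘         zero    a ψ g (suc x) = refl
insert-∘ {suc k} (suc j) a ψ g zero    = refl
insert-∘ {suc k} (suc j) a ψ g (suc x) = insert-∘ j a (ψ ∘ suc) g x

∑-extend : ∀ k m (f : (Fin (suc k) → Fin m) → ℕ) →
  ∑ f (allMaps (suc k) m) ≡ ∑ (λ a → ∑ (λ ψ → f (extend a ψ)) (allMaps k m)) (allFin m)
∑-extend k m f = trans (∑-concatMap f (λ a → map (extend a) (allMaps k m)) (allFin m))
  (∑-cong (allFin m) (λ a → ∑-map f (extend a) (allMaps k m)))

∑-insert : ∀ k m j (f : (Fin (suc k) → Fin m) → ℕ) →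
  ∑ f (allMaps (suc k) m) ≡ ∑ (λ a → ∑ (λ ψ → f (insert j a ψ)) (allMaps k m)) (allFin m)
∑-insert k       m zero    f = ∑-extend k m f
∑-insert (suc k) m (suc j) f = begin
  ∑ f (allMaps (suc (suc k)) m)
    ≡⟨ ∑-extend (suc k) m f ⟩
  ∑ (λ b → ∑ (λ φ → f (extend b φ)) (allMaps (suc k) m)) (allFin m)
    ≡⟨ ∑-cong (allFin m) (λ b → ∑-insert k m j (f ∘ extend b)) ⟩
  ∑ (λ b → ∑ (λ a → ∑ (λ ψ → f (extend b (insert j a ψ))) (allMaps k m)) (allFin m)) (allFin m)
    ≡⟨ ∑-swap (λ b a → ∑ (λ ψ → f (extend b (insert j a ψ))) (allMaps k m)) (allFin m) (allFin m) ⟩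
  ∑ (λ a → ∑ (λ b → ∑ (λ ψ → f (extend b (insert j a ψ))) (allMaps k m)) (allFin m)) (allFin m)
    -- The two summands agree definitionally: `insert (suc j) a (extend b ψ)` unfolds to
    -- `extend b (insert j a ψ)`.
    ≡⟨ ∑-cong (allFin m) (λ a → ∑-extend k m (f ∘ insert (suc j) a)) ⟨
  ∑ (λ a → ∑ (λ φ → f (insert (suc j) a φ)) (allMaps (suc k) m)) (allFin m) ∎
  where open ≡-Reasoning

length-allMaps : ∀ k m → length (allMaps (suc k) m) ≡ m * length (allMaps k m)
length-allMaps k m = begin
  length (allMaps (suc k) m)                          ≡⟨ ∑-1 (allMaps (suc k) m) ⟨
  ∑ (λ _ → 1) (allMaps (suc k) m)                     ≡⟨ ∑-extend k m (λ _ → 1) ⟩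
  ∑ (λ _ → ∑ (λ _ → 1) (allMaps k m)) (allFin m)      ≡⟨ ∑-const _ (allFin m) ⟩
  length (allFin m) * ∑ (λ _ → 1) (allMaps k m)       ≡⟨ cong₂ _*_ (List.length-tabulate {n = m} id) (∑-1 (allMaps k m)) ⟩
  m * length (allMaps k m)                            ∎
  where
  open ≡-Reasoning
  ∑-1 : ∀ {A : Set} (xs : List A) → ∑ (λ _ → 1) xs ≡ length xs
  ∑-1 xs = trans (∑-const 1 xs) (ℕ.*-identityʳ (length xs))

-- Maps built by `insert` and by composition agree only pointwise, so predicates on maps are
-- required to respect pointwise equality.
Extensional : ∀ {k m} → ((Fin k → Fin m) → Bool) → Set
Extensional p = ∀ {φ ψ} → (∀ x → φ x ≡ ψ x) → p φ ≡ p ψ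

-- The map sending j to the same value as i, and otherwise closing the gap left by j.
merge : ∀ {k} {j i : Fin (suc k)} → j ≢ i → Fin (suc k) → Fin k
merge {j = j} j≢i = insert j (punchOut j≢i) id

-- Sum over the value a at j and over the rest ψ of the map. The condition φ i ≡ φ j leaves only the
-- term in which a is the value of ψ at i, so the inner sum collapses by `∑-eqFin`, and the
-- surviving map is ψ composed with `merge`.
count-merge : ∀ k m {i j} (j≢i : j ≢ i) (p : (Fin (suc k) → Fin m) → Bool) → Extensional p →
  count (λ φ → eqFin (φ i) (φ j) ∧ p φ) (allMaps (suc k) m) ≡ count (λ ψ → p (ψ ∘ merge j≢i)) (allMaps k m)
count-merge k m {i} {j} j≢i p ext = begin
  count (λ φ → eqFin (φ i) (φ j) ∧ p φ) (allMaps (suc k) m)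
    ≡⟨ count≡∑ (λ φ → eqFin (φ i) (φ j) ∧ p φ) (allMaps (suc k) m) ⟩
  ∑ (λ φ → bit (eqFin (φ i) (φ j) ∧ p φ)) (allMaps (suc k) m)
    ≡⟨ ∑-insert k m j _ ⟩
  ∑ (λ a → ∑ (λ ψ → bit (eqFin (insert j a ψ i) (insert j a ψ j) ∧ p (insert j a ψ))) (allMaps k m)) (allFin m)
    ≡⟨ ∑-cong (allFin m) (λ a → ∑-cong (allMaps k m) λ ψ → trans
         (cong₂ (λ x y → bit (eqFin x y ∧ p (insert j a ψ))) (insert-punchOut j≢i a ψ) (insert-at j a ψ))
         (bit-∧ (eqFin (ψ i′) a) (p (insert j a ψ)))) ⟩
  ∑ (λ a → ∑ (λ ψ → bit (eqFin (ψ i′) a) * bit (p (insert j a ψ))) (allMaps k m)) (allFin m)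
    ≡⟨ ∑-swap (λ a ψ → bit (eqFin (ψ i′) a) * bit (p (insert j a ψ))) (allFin m) (allMaps k m) ⟩
  ∑ (λ ψ → ∑ (λ a → bit (eqFin (ψ i′) a) * bit (p (insert j a ψ))) (allFin m)) (allMaps k m)
    ≡⟨ ∑-cong (allMaps k m) (λ ψ → ∑-eqFin (λ a → bit (p (insert j a ψ))) (ψ i′)) ⟩
  ∑ (λ ψ → bit (p (insert j (ψ i′) ψ))) (allMaps k m)
    ≡⟨ ∑-cong (allMaps k m) (λ ψ → cong bit (ext (insert-∘ j i′ id ψ))) ⟩
  ∑ (λ ψ → bit (p (ψ ∘ merge j≢i))) (allMaps k m)
    ≡⟨ count≡∑ (λ ψ → p (ψ ∘ merge j≢i)) (allMaps k m) ⟨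
  count (λ ψ → p (ψ ∘ merge j≢i)) (allMaps k m) ∎
  where
  open ≡-Reasoning
  i′ = punchOut j≢i

count-pos : ∀ k m (p : (Fin k → Fin m) → Bool) → Extensional p → ∀ φ → p φ ≡ true → 1 ≤ count p (allMaps k m)
count-pos k m p ext φ pφ = go (allMaps k m) (complete k φ)
  where
  -- The enumeration contains a given map only up to pointwise equality.
  complete : ∀ k (φ : Fin k → Fin m) → ∃ λ ψ → ψ ∈ allMaps k m × (∀ x → φ x ≡ ψ x)
  complete zero    φ = (λ ()) , here refl , λ ()
  complete (suc k) φ with complete k (φ ∘ suc)
  ... | ψ , ψ∈ , φ≡ψ = extend (φ zero) ψ
    , ∈-concatMap⁺ (λ a → map (extend a) (allMaps k m)) (lose (∈-allFin (φ zero)) (∈-map⁺ (extend (φ zero)) ψ∈))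
    , λ { zero → refl ; (suc x) → φ≡ψ x }
  go : ∀ xs → (∃ λ ψ → ψ ∈ xs × (∀ x → φ x ≡ ψ x)) → 1 ≤ count p xs
  go (ψ ∷ xs) (ψ , here refl , φ≡ψ) rewrite trans (sym (ext φ≡ψ)) pφ = s≤s z≤n
  go (χ ∷ xs) (ψ , there ψ∈ , φ≡ψ) with p χ
  ... | true  = s≤s z≤n
  ... | false = go xs (ψ , ψ∈ , φ≡ψ)

pos-count⇒∃ : ∀ {A : Set} (p : A → Bool) xs → 1 ≤ count p xs → ∃ λ x → p x ≡ true
pos-count⇒∃ p (x ∷ xs) 1≤ with p x in px
... | true  = x , px
... | false = pos-count⇒∃ p xs 1≤

-- Counting by literals

∧-true : ∀ {a b} → a ≡ true → b ≡ true → a ∧ b ≡ true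
∧-true refl refl = refl

∧-trueˡ : ∀ {a b} → a ∧ b ≡ true → a ≡ true
∧-trueˡ {true} _ = refl

∧-trueʳ : ∀ {a b} → a ∧ b ≡ true → b ≡ true
∧-trueʳ {true} b = b

not-true : ∀ {a} → a ≡ false → not a ≡ true
not-true refl = refl

not-true⁻ : ∀ {a} → not a ≡ true → a ≡ false
not-true⁻ {false} _ = refl

≢true⇒false : ∀ {a} → a ≢ true → a ≡ false
≢true⇒false {false} _ = refl
≢true⇒false {true}  a≢t = contradiction refl a≢t

⇒b-true : ∀ {a b} → (a ≡ true → b ≡ true) → (a ⇒b b) ≡ true
⇒b-true {false} a⇒b = refl
⇒b-true {true}  a⇒b = a⇒b refl

⇒b-true⁻ : ∀ {a b} → (a ⇒b b) ≡ true → a ≡ true → b ≡ true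
⇒b-true⁻ a⇒b refl = a⇒b

⇔b-true : ∀ {a b} → a ≡ b → (a ⇔b b) ≡ true
⇔b-true {false} refl = refl
⇔b-true {true}  refl = refl

⇔b-true⁻ : ∀ {a b} → (a ⇔b b) ≡ true → b ≡ a
⇔b-true⁻ {false} eq = not-true⁻ eq
⇔b-true⁻ {true}  eq = eq

allb-true : ∀ {A : Set} {p : A → Bool} xs → (∀ {x} → x ∈ xs → p x ≡ true) → allb p xs ≡ true
allb-true []       all = refl
allb-true (x ∷ xs) all = ∧-true (all (here refl)) (allb-true xs (all ∘ there))

allb-true⁻ : ∀ {A : Set} {p : A → Bool} {xs} → allb p xs ≡ true → ∀ {x} → x ∈ xs → p x ≡ true
allb-true⁻ all (here refl) = ∧-trueˡ all
allb-true⁻ all (there x∈)  = allb-true⁻ (∧-trueʳ all) x∈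

forallPairs-true : ∀ {k} {p : Fin k → Fin k → Bool} → (∀ i j → p i j ≡ true) → forallPairs p ≡ true
forallPairs-true {k} all = allb-true (allFin k) λ {i} _ → allb-true (allFin k) λ {j} _ → all i j

forallPairs-true⁻ : ∀ {k} {p : Fin k → Fin k → Bool} → forallPairs p ≡ true → ∀ i j → p i j ≡ true
forallPairs-true⁻ all i j = allb-true⁻ (allb-true⁻ all (∈-allFin i)) (∈-allFin j)

-- No literal expresses equal values: such a constraint is absorbed by `merge` into a smaller vertex
-- set.
data Lit (k : ℕ) : Set where
  pos neg neq : Fin k × Fin k → Lit k

pairs : ∀ k → List (Fin k × Fin k)
pairs k = cartesianProduct (allFin k) (allFin k)

∈-pairs : ∀ {k} (e : Fin k × Fin k) → e ∈ pairs k
∈-pairs (i , j) = ∈-cartesianProduct⁺ (∈-allFin i) (∈-allFin j)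

offDiagonal : ∀ k → List (Fin k × Fin k)
offDiagonal k = filter (λ e → ¬? (proj₁ e Fin.≟ proj₂ e)) (pairs k)

∈-offDiagonal : ∀ {k} {i j : Fin k} → i ≢ j → (i , j) ∈ offDiagonal k
∈-offDiagonal i≢j = ∈-filter⁺ _ (∈-pairs _) i≢j

∈-offDiagonal⁻ : ∀ {k} {i j : Fin k} → (i , j) ∈ offDiagonal k → i ≢ j
∈-offDiagonal⁻ {k} e∈ = proj₂ (∈-filter⁻ (λ e → ¬? (proj₁ e Fin.≟ proj₂ e)) {xs = pairs k} e∈)

edges nonedges : (F : Digraph) → List (Fin (size F) × Fin (size F))
edges    F = filter (λ e → edge F (proj₁ e) (proj₂ e) Bool.≟ true)  (pairs (size F))
nonedges F = filter (λ e → edge F (proj₁ e) (proj₂ e) Bool.≟ false) (pairs (size F))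

∈-edges : ∀ F {i j} → edge F i j ≡ true → (i , j) ∈ edges F
∈-edges F ij = ∈-filter⁺ _ (∈-pairs _) ij

∈-edges⁻ : ∀ F {i j} → (i , j) ∈ edges F → edge F i j ≡ true
∈-edges⁻ F e∈ = proj₂ (∈-filter⁻ (λ e → edge F (proj₁ e) (proj₂ e) Bool.≟ true) {xs = pairs (size F)} e∈)

∈-nonedges : ∀ F {i j} → edge F i j ≡ false → (i , j) ∈ nonedges F
∈-nonedges F ij = ∈-filter⁺ _ (∈-pairs _) ij

∈-nonedges⁻ : ∀ F {i j} → (i , j) ∈ nonedges F → edge F i j ≡ false
∈-nonedges⁻ F e∈ = proj₂ (∈-filter⁻ (λ e → edge F (proj₁ e) (proj₂ e) Bool.≟ false) {xs = pairs (size F)} e∈)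

distinct : ∀ k → List (Lit k)
distinct k = map neq (offDiagonal k)

ren : ∀ {k l} → (Fin k → Fin l) → Lit k → Lit l
ren r (pos (i , j)) = pos (r i , r j)
ren r (neg (i , j)) = neg (r i , r j)
ren r (neq (i , j)) = neq (r i , r j)

module _ (G : Digraph) where

  holds : ∀ {k} → (Fin k → Fin (size G)) → Lit k → Bool
  holds φ (pos (i , j)) = edge G (φ i) (φ j)
  holds φ (neg (i , j)) = not (edge G (φ i) (φ j))
  holds φ (neq (i , j)) = not (eqFin (φ i) (φ j))

  sat : ∀ {k} → List (Lit k) → (Fin k → Fin (size G)) → Bool
  sat L φ = allb (holds φ) L

  # : ∀ {k} → List (Lit k) → ℕ
  # {k} L = count (sat L) (allMaps k (size G))

  sat-ext : ∀ {k} (L : List (Lit k)) → Extensional (sat L)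
  sat-ext []               φ≡ψ = refl
  sat-ext (pos (i , j) ∷ L) φ≡ψ = cong₂ _∧_ (cong₂ (edge G) (φ≡ψ i) (φ≡ψ j)) (sat-ext L φ≡ψ)
  sat-ext (neg (i , j) ∷ L) φ≡ψ = cong₂ _∧_ (cong not (cong₂ (edge G) (φ≡ψ i) (φ≡ψ j))) (sat-ext L φ≡ψ)
  sat-ext (neq (i , j) ∷ L) φ≡ψ = cong₂ _∧_ (cong not (cong₂ eqFin (φ≡ψ i) (φ≡ψ j))) (sat-ext L φ≡ψ)

  sat-ren : ∀ {k l} (r : Fin k → Fin l) L ψ → sat L (ψ ∘ r) ≡ sat (map (ren r) L) ψ
  sat-ren r []               ψ = refl
  sat-ren r (pos (i , j) ∷ L) ψ = cong (_ ∧_) (sat-ren r L ψ)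
  sat-ren r (neg (i , j) ∷ L) ψ = cong (_ ∧_) (sat-ren r L ψ)
  sat-ren r (neq (i , j) ∷ L) ψ = cong (_ ∧_) (sat-ren r L ψ)

  sat-⊆ : ∀ {k} {L L′ : List (Lit k)} → L ⊆ L′ → ∀ φ → sat L′ φ ≡ true → sat L φ ≡ true
  sat-⊆ {L = L} L⊆L′ φ s = allb-true L λ l∈ → allb-true⁻ s (L⊆L′ l∈)

  #-anti : ∀ {k} {L L′ : List (Lit k)} → L ⊆ L′ → # L′ ≤ # L
  #-anti {k} L⊆L′ = count-mono (allMaps k (size G)) (sat-⊆ L⊆L′)

  #-cong : ∀ {k} {L L′ : List (Lit k)} → L ⊆ L′ → L′ ⊆ L → # L ≡ # L′
  #-cong L⊆L′ L′⊆L = ℕ.≤-antisym (#-anti L′⊆L) (#-anti L⊆L′)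

  #-[] : ∀ k → # {k} [] ≡ length (allMaps k (size G))
  #-[] k = count-true (allMaps k (size G))

  #-pos-neg : ∀ {k} e (L : List (Lit k)) → # L ≡ # (pos e ∷ L) + # (neg e ∷ L)
  #-pos-neg {k} (i , j) L = count-split (sat L) (λ φ → edge G (φ i) (φ j)) (allMaps k (size G))

  #-neq-merge : ∀ {k} {i j} (j≢i : j ≢ i) (L : List (Lit (suc k))) →
    # L ≡ # (neq (i , j) ∷ L) + # (map (ren (merge j≢i)) L)
  #-neq-merge {k} {i} {j} j≢i L = begin
    # L ≡⟨ count-split (sat L) (λ φ → eqFin (φ i) (φ j)) (allMaps (suc k) (size G)) ⟩
    count (λ φ → eqFin (φ i) (φ j) ∧ sat L φ) (allMaps (suc k) (size G)) + # (neq (i , j) ∷ L)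
      ≡⟨ ℕ.+-comm _ (# (neq (i , j) ∷ L)) ⟩
    # (neq (i , j) ∷ L) + count (λ φ → eqFin (φ i) (φ j) ∧ sat L φ) (allMaps (suc k) (size G))
      ≡⟨ cong (# (neq (i , j) ∷ L) ℕ.+_) (count-merge k (size G) j≢i (sat L) (sat-ext L)) ⟩
    # (neq (i , j) ∷ L) + count (λ ψ → sat L (ψ ∘ merge j≢i)) (allMaps k (size G))
      ≡⟨ cong (# (neq (i , j) ∷ L) ℕ.+_) (count-cong (allMaps k (size G))
           (λ ψ s → trans (sym (sat-ren (merge j≢i) L ψ)) s) (λ ψ s → trans (sat-ren (merge j≢i) L ψ) s)) ⟩
    # (neq (i , j) ∷ L) + # (map (ren (merge j≢i)) L) ∎
    where open ≡-Reasoning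

  #-unsat : ∀ {k} (L : List (Lit k)) → (∀ φ → sat L φ ≢ true) → # L ≡ 0
  #-unsat {k} L unsat = count-false (allMaps k (size G)) (λ φ → ≢true⇒false (unsat φ))

  #-pos∧neg : ∀ {k} {L : List (Lit k)} e → pos e ∈ L → neg e ∈ L → # L ≡ 0
  #-pos∧neg {L = L} e p∈ n∈ = #-unsat L λ φ s →
    contradiction (trans (sym (allb-true⁻ s p∈)) (not-true⁻ (allb-true⁻ s n∈))) λ ()

  #-neq-diagonal : ∀ {k} {L : List (Lit k)} i → neq (i , i) ∈ L → # L ≡ 0
  #-neq-diagonal {L = L} i n∈ = #-unsat L λ φ s →
    contradiction (trans (sym (≡⇒eqFin {a = φ i} refl)) (not-true⁻ (allb-true⁻ s n∈))) λ ()

  sat-distinct : ∀ {k} (φ : Fin k → Fin (size G)) → sat (distinct k) φ ≡ true → isInj φ ≡ true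
  sat-distinct φ s = forallPairs-true λ i j → ⇒b-true λ φi≡φj → inj i j φi≡φj
    where
    inj : ∀ i j → eqFin (φ i) (φ j) ≡ true → eqFin i j ≡ true
    inj i j φi≡φj with i Fin.≟ j
    ... | yes _  = refl
    ... | no i≢j = trans (sym (not-true⁻ (allb-true⁻ s (∈-map⁺ neq (∈-offDiagonal i≢j))))) φi≡φj

  sat-distinct⁻ : ∀ {k} (φ : Fin k → Fin (size G)) → isInj φ ≡ true → sat (distinct k) φ ≡ true
  sat-distinct⁻ {k} φ inj = allb-true (distinct k) λ l∈ → go l∈ (∈-map⁻ neq l∈)
    where
    go : ∀ {l} → l ∈ distinct k → (∃ λ e → e ∈ offDiagonal k × l ≡ neq e) → holds φ l ≡ true
    go _ ((i , j) , e∈ , refl) = not-true (≢true⇒false λ φi≡φj →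
      ∈-offDiagonal⁻ e∈ (eqFin⇒≡ (⇒b-true⁻ (forallPairs-true⁻ inj i j) φi≡φj)))

  sat-++ : ∀ {k} (L L′ : List (Lit k)) φ → sat L φ ≡ true → sat L′ φ ≡ true → sat (L ++ L′) φ ≡ true
  sat-++ L L′ φ s s′ = allb-true (L ++ L′) λ l∈ → [ allb-true⁻ s , allb-true⁻ s′ ]′ (∈-++⁻ L l∈)

  sat-++ˡ : ∀ {k} (L L′ : List (Lit k)) φ → sat (L ++ L′) φ ≡ true → sat L φ ≡ true
  sat-++ˡ L L′ φ = sat-⊆ {L = L} {L ++ L′} ∈-++⁺ˡ φ

  sat-++ʳ : ∀ {k} (L L′ : List (Lit k)) φ → sat (L ++ L′) φ ≡ true → sat L′ φ ≡ true
  sat-++ʳ L L′ φ = sat-⊆ {L = L′} {L ++ L′} (∈-++⁺ʳ L) φ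

  sat-pos : ∀ {k} (A : List (Fin k × Fin k)) φ →
    (∀ {i j} → (i , j) ∈ A → edge G (φ i) (φ j) ≡ true) → sat (map pos A) φ ≡ true
  sat-pos A φ hom = allb-true (map pos A) λ l∈ → go (∈-map⁻ pos l∈)
    where
    go : ∀ {l} → (∃ λ e → e ∈ A × l ≡ pos e) → holds φ l ≡ true
    go (_ , e∈ , refl) = hom e∈

  sat-neg : ∀ {k} (B : List (Fin k × Fin k)) φ →
    (∀ {i j} → (i , j) ∈ B → edge G (φ i) (φ j) ≡ false) → sat (map neg B) φ ≡ true
  sat-neg B φ non = allb-true (map neg B) λ l∈ → go (∈-map⁻ neg l∈)
    where
    go : ∀ {l} → (∃ λ e → e ∈ B × l ≡ neg e) → holds φ l ≡ true
    go (_ , e∈ , refl) = not-true (non e∈)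

  #-distinct : ∀ k → count isInj (allMaps k (size G)) ≡ # (distinct k)
  #-distinct k = count-cong (allMaps k (size G)) sat-distinct⁻ sat-distinct

  module _ (F : Digraph) where
    private
      k = size F
      E = map pos (edges F)
      N = map neg (nonedges F)

    sat-edges : ∀ φ → isHom F G φ ≡ true → sat E φ ≡ true
    sat-edges φ hom = sat-pos (edges F) φ λ {i} {j} e∈ → ⇒b-true⁻ (forallPairs-true⁻ hom i j) (∈-edges⁻ F e∈)

    sat-edges⁻ : ∀ φ → sat E φ ≡ true → isHom F G φ ≡ true
    sat-edges⁻ φ s = forallPairs-true {k} λ i j → ⇒b-true {edge F i j} λ ij → allb-true⁻ s (∈-map⁺ pos (∈-edges F ij))

    t-# : t F G ≡ frac (# E) (# {k} [])
    t-# = cong₂ frac (count-cong (maps F G) sat-edges sat-edges⁻) (sym (#-[] k))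

    tinj-# : tinj F G ≡ frac (# (E ++ distinct k)) (# (distinct k))
    tinj-# = cong₂ frac (count-cong (maps F G)
      (λ φ h → sat-++ E (distinct k) φ (sat-edges φ (∧-trueʳ h)) (sat-distinct⁻ φ (∧-trueˡ h)))
      (λ φ s → ∧-true (sat-distinct φ (sat-++ʳ E (distinct k) φ s)) (sat-edges⁻ φ (sat-++ˡ E (distinct k) φ s))))
      (#-distinct k)

    tind-# : tind F G ≡ frac (# ((N ++ E) ++ distinct k)) (# (distinct k))
    tind-# = cong₂ frac (count-cong (maps F G)
      (λ φ h → sat-++ (N ++ E) (distinct k) φ
        (sat-++ N E φ
          (sat-neg (nonedges F) φ λ {i} {j} e∈ → trans (⇔b-true⁻ (forallPairs-true⁻ (∧-trueʳ h) i j)) (∈-nonedges⁻ F e∈))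
          (sat-pos (edges F) φ λ {i} {j} e∈ → trans (⇔b-true⁻ (forallPairs-true⁻ (∧-trueʳ h) i j)) (∈-edges⁻ F e∈)))
        (sat-distinct⁻ φ (∧-trueˡ h)))
      (λ φ s → ∧-true (sat-distinct φ (sat-++ʳ (N ++ E) (distinct k) φ s))
        (forallPairs-true λ i j → ⇔b-true (iso φ (sat-++ˡ (N ++ E) (distinct k) φ s) i j))))
      (#-distinct k)
      where
      iso : ∀ φ → sat (N ++ E) φ ≡ true → ∀ i j → edge F i j ≡ edge G (φ i) (φ j)
      iso φ s i j with edge F i j in ij
      ... | true  = sym (allb-true⁻ (sat-++ʳ N E φ s) (∈-map⁺ pos (∈-edges F ij)))
      ... | false = sym (not-true⁻ (allb-true⁻ (sat-++ˡ N E φ s) (∈-map⁺ neg (∈-nonedges F ij))))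

  -- Union bound: each coincidence φ i ≡ φ j with i ≢ j is realised by # {k} [] maps.
  #-[]-bound : ∀ {k} (E : List (Fin (suc k) × Fin (suc k))) → (∀ {i j} → (i , j) ∈ E → i ≢ j) →
    # {suc k} [] ≤ # (map neq E) + length E * # {k} []
  #-[]-bound {k} []      off = ℕ.m≤m+n _ 0
  #-[]-bound {k} ((i , j) ∷ E) off = begin
    # {suc k} []                                          ≤⟨ #-[]-bound E (off ∘ there) ⟩
    # (map neq E) + length E * T                          ≡⟨ cong (_+ length E * T) (#-neq-merge j≢i (map neq E)) ⟩
    (# (neq (i , j) ∷ map neq E) + # L) + length E * T    ≤⟨ ℕ.+-monoˡ-≤ (length E * T) (ℕ.+-monoʳ-≤ _ (#-anti {L = []} {L} λ ())) ⟩
    (# (neq (i , j) ∷ map neq E) + T) + length E * T      ≡⟨ ℕ.+-assoc (# (neq (i , j) ∷ map neq E)) T (length E * T) ⟩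
    # (neq (i , j) ∷ map neq E) + (T + length E * T)      ∎
    where
    open ℕ.≤-Reasoning
    T = # {k} []
    j≢i : j ≢ i
    j≢i j≡i = off (here refl) (sym j≡i)
    L = map (ren (merge j≢i)) (map neq E)

  size*#-[]-bound : ∀ k → size G * # {suc k} [] ≤ size G * # (distinct (suc k)) + length (offDiagonal (suc k)) * # {suc k} []
  size*#-[]-bound k = begin
    size G * # {suc k} []                      ≤⟨ ℕ.*-monoʳ-≤ (size G) (#-[]-bound {k} (offDiagonal (suc k)) ∈-offDiagonal⁻) ⟩
    size G * (# (distinct (suc k)) + C * # {k} [])    ≡⟨ rearrange (size G) (# (distinct (suc k))) C (# {k} []) ⟩
    size G * # (distinct (suc k)) + C * (size G * # {k} [])
      -- The factor |G| turns the number of maps on k vertices into the number on k + 1 vertices, so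
      -- that the same total stands on both sides, as `frac-dist` requires.
      ≡⟨ cong (λ x → size G * # (distinct (suc k)) + C * x) (trans (cong (size G *_) (#-[] k)) (trans (sym (length-allMaps k (size G))) (sym (#-[] (suc k))))) ⟩
    size G * # (distinct (suc k)) + C * # {suc k} []  ∎
    where
    open ℕ.≤-Reasoning
    C = length (offDiagonal (suc k))
    rearrange : ∀ s d c t → s * (d + c * t) ≡ s * d + c * (s * t)
    rearrange = solve-∀

  #-++ : ∀ {k} (L L′ : List (Lit k)) → # L + # L′ ≤ # (L ++ L′) + # {k} []
  #-++ {k} L L′ = begin
    # L + # L′          ≤⟨ count-∧-∨ (sat L) (sat L′) (allMaps k (size G)) ⟩
    count (λ φ → sat L φ ∧ sat L′ φ) (allMaps k (size G)) + length (allMaps k (size G))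
      ≤⟨ ℕ.+-mono-≤ (count-mono (allMaps k (size G)) (λ φ s → sat-++ L L′ φ (∧-trueˡ s) (∧-trueʳ s))) (ℕ.≤-reflexive (sym (#-[] k))) ⟩
    # (L ++ L′) + # {k} [] ∎
    where open ℕ.≤-Reasoning

  #-distinct-pos : ∀ k → k ≤ size G → 1 ≤ # (distinct k)
  #-distinct-pos k k≤ = count-pos k (size G) (sat (distinct k)) (sat-ext (distinct k)) (λ i → Fin.inject≤ i k≤)
    (sat-distinct⁻ {k} (λ i → Fin.inject≤ i k≤) (forallPairs-true {k} λ i j → ⇒b-true λ eq → ≡⇒eqFin (Fin.inject≤-injective k≤ k≤ i j (eqFin⇒≡ eq))))

  #-distinct-pos⁻ : ∀ k → 1 ≤ # (distinct k) → k ≤ size G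
  #-distinct-pos⁻ k 1≤ with pos-count⇒∃ (sat (distinct k)) (allMaps k (size G)) 1≤
  ... | φ , s = Fin.injective⇒≤ {f = φ} λ {i} {j} φi≡φj →
    eqFin⇒≡ (⇒b-true⁻ (forallPairs-true⁻ (sat-distinct φ s) i j) (≡⇒eqFin φi≡φj))

  #-[]-pos : ∀ k → 1 ≤ size G → 1 ≤ # {k} []
  #-[]-pos k 1≤ = count-pos k (size G) (λ _ → true) (λ _ → refl) (λ _ → Fin.fromℕ< 1≤) refl

-- Passing between the densities

_∈?_ : ∀ {k} (e : Fin k × Fin k) A → Dec (e ∈ A)
_∈?_ = member? (≡-dec Fin._≟_ Fin._≟_)

-- Inverse to `edges` up to order and repetition, which is why counts are compared through
-- inclusions of literal lists in both directions.
fromEdges : ∀ {k} → 1 ≤ k → List (Fin k × Fin k) → Digraph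
fromEdges {k} 1≤k A = record { size = k ; nonempty = 1≤k ; edge = λ i j → does ((i , j) ∈? A) }

module _ {k} (1≤k : 1 ≤ k) (A : List (Fin k × Fin k)) where

  edges-fromEdges⊆ : edges (fromEdges 1≤k A) ⊆ A
  edges-fromEdges⊆ {i , j} e∈ with (i , j) ∈? A | ∈-edges⁻ (fromEdges 1≤k A) e∈
  ... | yes e∈A | _ = e∈A
  ... | no _    | ()

  edges-fromEdges⊇ : A ⊆ edges (fromEdges 1≤k A)
  edges-fromEdges⊇ {i , j} e∈ = ∈-edges (fromEdges 1≤k A) (dec-true ((i , j) ∈? A) e∈)

  ∈-nonedges-fromEdges : ∀ {e} → e ∉ A → e ∈ nonedges (fromEdges 1≤k A)
  ∈-nonedges-fromEdges {i , j} e∉ = ∈-nonedges (fromEdges 1≤k A) (dec-false ((i , j) ∈? A) e∉)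

  ∈-nonedges-fromEdges⁻ : ∀ {e} → e ∈ nonedges (fromEdges 1≤k A) → e ∉ A
  ∈-nonedges-fromEdges⁻ {i , j} e∈ e∈A =
    contradiction (trans (sym (dec-true ((i , j) ∈? A) e∈A)) (∈-nonedges⁻ (fromEdges 1≤k A) e∈)) λ ()

t-tinj-dist : ∀ F G → size F ≤ size G → ∣ t F G ℚ.- tinj F G ∣ ℚ.≤ frac (length (offDiagonal (size F))) (size G)
t-tinj-dist F@(record { size = suc k }) G k<N = subst₂ (λ x y → ∣ x ℚ.- y ∣ ℚ.≤ frac (length (offDiagonal (suc k))) (size G))
  (sym (t-# G F)) (sym (tinj-# G F))
  (frac-dist (# G E) (# G (E ++ D)) (# G {suc k} []) (# G D) (size G) (length (offDiagonal (suc k)))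
    (#-[]-pos G (suc k) (Digraph.nonempty G)) (#-distinct-pos G (suc k) k<N) (Digraph.nonempty G)
    (#-anti G {L = E} {E ++ D} ∈-++⁺ˡ) (#-anti G {L = D} {E ++ D} (∈-++⁺ʳ E)) (#-anti G {L = []} {D} λ ())
    (#-++ G E D) (size*#-[]-bound G k))
  where
  E = map pos (edges F)
  D = distinct (suc k)

both : ∀ {k l} → (Fin k → Fin l) → Fin k × Fin k → Fin l × Fin l
both r = Product.map r r

map-ren : ∀ {k l} (r : Fin k → Fin l) E A →
  map (ren r) (map neq E ++ map pos A) ≡ map neq (map (both r) E) ++ map pos (map (both r) A)
map-ren r E A = trans (List.map-++ (ren r) (map neq E) (map pos A))
  (cong₂ _++_ (trans (sym (List.map-∘ E)) (List.map-∘ E)) (trans (sym (List.map-∘ A)) (List.map-∘ A)))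

-- Digraphs are non-empty, so the vertex set left after merging two distinct vertices has to be
-- non-empty as well.
≢⇒1≤ : ∀ {k} {i j : Fin (suc k)} → i ≢ j → 1 ≤ k
≢⇒1≤ {zero}  {zero} {zero} i≢j = contradiction refl i≢j
≢⇒1≤ {suc k} i≢j = s≤s z≤n

module _ (G : ℕ → Digraph) where

  HomConverges InjConverges IndConverges SizeConverges : Set
  HomConverges  = ∀ F → Converges (λ n → t F (G n))
  InjConverges  = ∀ F → Converges (λ n → tinj F (G n))
  IndConverges  = ∀ F → Converges (λ n → tind F (G n))
  SizeConverges = ConvergesInℕ∞ (λ n → size (G n))

  -- A common generalisation of t_inj (edge literals only) and t_ind (every pair decided). The
  -- denominator depends on k alone, so splitting along an edge is an identity between densities.
  tinjᴸ : ∀ {k} → List (Lit k) → ℕ → ℚ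
  tinjᴸ {k} L n = frac (# (G n) (L ++ distinct k)) (# (G n) (distinct k))

  tinjᴸ-cong : ∀ {k} {L L′ : List (Lit k)} → L ⊆ L′ → L′ ⊆ L → ∀ n → tinjᴸ L n ≡ tinjᴸ L′ n
  tinjᴸ-cong {k} L⊆L′ L′⊆L n = cong (λ x → frac x (# (G n) (distinct k)))
    (#-cong (G n) (++⁺ L⊆L′ ⊆-refl) (++⁺ L′⊆L ⊆-refl))

  tinjᴸ-split : ∀ {k} e (L : List (Lit k)) n → tinjᴸ L n ≡ tinjᴸ (neg e ∷ L) n ℚ.+ tinjᴸ (pos e ∷ L) n
  tinjᴸ-split {k} e L n = trans (cong (λ x → frac x (# (G n) (distinct k)))
    (trans (#-pos-neg (G n) e (L ++ distinct k)) (ℕ.+-comm (# (G n) (pos e ∷ L ++ distinct k)) (# (G n) (neg e ∷ L ++ distinct k)))))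
    (frac-+ (# (G n) (neg e ∷ L ++ distinct k)) (# (G n) (pos e ∷ L ++ distinct k)) (# (G n) (distinct k)))

  tinjᴸ-shift : ∀ {k} e (B A : List (Fin k × Fin k)) n →
    tinjᴸ (map neg B ++ map pos (e ∷ A)) n ≡ tinjᴸ (pos e ∷ map neg B ++ map pos A) n
  tinjᴸ-shift e B A = tinjᴸ-cong (⊆-reflexive-↭ perm) (⊆-reflexive-↭ (↭-sym perm))
    where
    perm : map neg B ++ map pos (e ∷ A) ↭ pos e ∷ map neg B ++ map pos A
    perm = shift (pos e) (map neg B) (map pos A)

  -- Induction on the number of non-edge literals: forbidding e is the difference between not
  -- mentioning e and requiring e, and both of these have one non-edge less. Requiring e enlarges
  -- `A`, hence the quantification over all `A`.
  Inj⇒tinjᴸ : InjConverges → ∀ {k} → 1 ≤ k → ∀ B (A : List (Fin k × Fin k)) → Converges (tinjᴸ (map neg B ++ map pos A))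
  Inj⇒tinjᴸ inj 1≤k []      A = Converges-cong
    (λ n → trans (tinj-# (G n) F) (tinjᴸ-cong (map⁺ pos (edges-fromEdges⊆ 1≤k A)) (map⁺ pos (edges-fromEdges⊇ 1≤k A)) n))
    (inj F)
    where F = fromEdges 1≤k A
  Inj⇒tinjᴸ inj 1≤k (e ∷ B) A = Converges-∸ {tinjᴸ L} {tinjᴸ (neg e ∷ L)} {tinjᴸ (pos e ∷ L)} (tinjᴸ-split e L)
    (Inj⇒tinjᴸ inj 1≤k B A)
    (Converges-cong (tinjᴸ-shift e B A) (Inj⇒tinjᴸ inj 1≤k B (e ∷ A)))
    where L = map neg B ++ map pos A

  Inj⇒Ind : InjConverges → IndConverges
  Inj⇒Ind inj F = Converges-cong (λ n → sym (tind-# (G n) F))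
    (Inj⇒tinjᴸ inj (Digraph.nonempty F) (nonedges F) (edges F))

  -- `U` lists the pairs still to be decided; each is split into its two cases. When `U` is
  -- exhausted, every pair is required or forbidden, and a consistent list of literals describes an
  -- induced digraph.
  Ind⇒tinjᴸ : IndConverges → ∀ {k} → 1 ≤ k → ∀ (U A B : List (Fin k × Fin k)) →
    (∀ e → e ∈ A ⊎ e ∈ B ⊎ e ∈ U) → Converges (tinjᴸ (map neg B ++ map pos A))
  Ind⇒tinjᴸ ind {k} 1≤k [] A B cover with any? (_∈? B) A
  -- `U` may list pairs already in `A`; on the branch that forbids such a pair the literals
  -- contradict each other.
  ... | yes A∩B = Converges-cong (λ n → sym (vanish n)) (Converges-const 0ℚ)
    where
    e = proj₁ (find A∩B)
    vanish : ∀ n → tinjᴸ (map neg B ++ map pos A) n ≡ 0ℚ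
    vanish n = frac-0 (# (G n) (distinct k))
      (#-pos∧neg (G n) e (∈-++⁺ˡ (∈-++⁺ʳ (map neg B) (∈-map⁺ pos (proj₁ (proj₂ (find A∩B))))))
                         (∈-++⁺ˡ (∈-++⁺ˡ (∈-map⁺ neg (proj₂ (proj₂ (find A∩B)))))))
  ... | no A∩B=∅ = Converges-cong (λ n → trans (tind-# (G n) F) (tinjᴸ-cong
      (++⁺ (map⁺ neg nonedges⊆B) (map⁺ pos (edges-fromEdges⊆ 1≤k A)))
      (++⁺ (map⁺ neg B⊆nonedges) (map⁺ pos (edges-fromEdges⊇ 1≤k A))) n)) (ind F)
    where
    F = fromEdges 1≤k A
    nonedges⊆B : nonedges F ⊆ B
    nonedges⊆B {e} e∈ with cover e
    ... | inj₁ e∈A = contradiction e∈A (∈-nonedges-fromEdges⁻ 1≤k A e∈)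
    ... | inj₂ (inj₁ e∈B) = e∈B
    B⊆nonedges : B ⊆ nonedges F
    B⊆nonedges e∈B = ∈-nonedges-fromEdges 1≤k A λ e∈A → A∩B=∅ (lose e∈A e∈B)
  Ind⇒tinjᴸ ind 1≤k (e ∷ U) A B cover = Converges-cong (λ n → sym (tinjᴸ-split e L n))
    (Converges-+ {tinjᴸ (neg e ∷ L)} {tinjᴸ (pos e ∷ L)} (Ind⇒tinjᴸ ind 1≤k U A (e ∷ B) cover-neg)
      (Converges-cong (tinjᴸ-shift e B A) (Ind⇒tinjᴸ ind 1≤k U (e ∷ A) B cover-pos)))
    where
    L = map neg B ++ map pos A
    cover-neg : ∀ e′ → e′ ∈ A ⊎ e′ ∈ e ∷ B ⊎ e′ ∈ U
    cover-neg e′ with cover e′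
    ... | inj₁ e′∈A                 = inj₁ e′∈A
    ... | inj₂ (inj₁ e′∈B)          = inj₂ (inj₁ (there e′∈B))
    ... | inj₂ (inj₂ (here e′≡e))   = inj₂ (inj₁ (here e′≡e))
    ... | inj₂ (inj₂ (there e′∈U))  = inj₂ (inj₂ e′∈U)
    cover-pos : ∀ e′ → e′ ∈ e ∷ A ⊎ e′ ∈ B ⊎ e′ ∈ U
    cover-pos e′ with cover e′
    ... | inj₁ e′∈A                 = inj₁ (there e′∈A)
    ... | inj₂ (inj₁ e′∈B)          = inj₂ (inj₁ e′∈B)
    ... | inj₂ (inj₂ (here e′≡e))   = inj₁ (here e′≡e)
    ... | inj₂ (inj₂ (there e′∈U))  = inj₂ (inj₂ e′∈U)

  Ind⇒Inj : IndConverges → InjConverges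
  Ind⇒Inj ind F = Converges-cong
    (λ n → trans (tinjᴸ-cong (map⁺ pos (edges-fromEdges⊆ 1≤k E)) (map⁺ pos (edges-fromEdges⊇ 1≤k E)) n) (sym (tinj-# (G n) F)))
    (Ind⇒tinjᴸ ind 1≤k (pairs (size F)) E′ [] (λ e → inj₂ (inj₂ (∈-pairs e))))
    where
    1≤k = Digraph.nonempty F
    E = edges F
    E′ = edges (fromEdges 1≤k E)

  -- Homomorphism and injective densities for eventually constant size

  module _ (sizeᴱᶜ : EventuallyConstant (λ n → size (G n))) where

    size-EC : (f : ℕ → ℕ) → EventuallyConstant (λ n → f (size (G n)))
    size-EC f = EC-map₂ {λ n → size (G n)} {λ n → size (G n)} (λ m _ → f m) sizeᴱᶜ sizeᴱᶜ

    #-[]-EC : ∀ k → EventuallyConstant (λ n → # (G n) {k} [])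
    #-[]-EC k = EC-cong (λ n → sym (#-[] (G n) k)) (size-EC (λ m → length (allMaps k m)))

    #-distinct-EC : ∀ k → EventuallyConstant (λ n → # (G n) (distinct k))
    #-distinct-EC k = EC-cong (λ n → #-distinct (G n) k) (size-EC (λ m → count isInj (allMaps k m)))

    Hom⇒#-EC : HomConverges → ∀ {l} E {k} → 1 ≤ k → (r : Fin l → Fin k) (A : List (Fin k × Fin k)) →
      EventuallyConstant (λ n → # (G n) (map neq (map (both r) E) ++ map pos A))
    Hom⇒#-EC hom [] {k} 1≤k r A = EC-cong
      (λ n → #-cong (G n) (map⁺ pos (edges-fromEdges⊆ 1≤k A)) (map⁺ pos (edges-fromEdges⊇ 1≤k A)))
      (Converges⇒EC {λ n → # (G n) E} (#-[]-EC k) (λ n → #-anti (G n) {L = []} {E} λ ())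
        (Converges-cong (λ n → t-# (G n) F) (hom F)))
      where
      F = fromEdges 1≤k A
      E = map pos (edges F)
    Hom⇒#-EC hom ((i , j) ∷ E) {suc k} 1≤k r A with r j Fin.≟ r i
    -- Earlier mergings may already have identified the two ends; then the literal cannot be
    -- satisfied.
    ... | yes rj≡ri = 0 , λ m n _ _ → trans (vanish m) (sym (vanish n))
      where
      vanish : ∀ n → # (G n) (neq (r i , r j) ∷ map neq (map (both r) E) ++ map pos A) ≡ 0
      vanish n = #-neq-diagonal (G n) {L = neq (r i , r j) ∷ map neq (map (both r) E) ++ map pos A} (r i) (here (cong (λ x → neq (r i , x)) (sym rj≡ri)))
    -- Both counts come from the shorter list `E`: it keeps the original vertex names, and merging
    -- changes only the renaming `r` and the edges `A`, so the recursion stays structural. The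
    -- truncated subtraction is exact, since the merged count is a summand of `# (G n) L`.
    ... | no rj≢ri = EC-cong difference (EC-map₂ {λ n → # (G n) L} {λ n → # (G n) (map (ren c) L)} _∸_
      (Hom⇒#-EC hom E 1≤k r A)
      (subst (λ L′ → EventuallyConstant (λ n → # (G n) L′)) (sym renamed)
        (Hom⇒#-EC hom E (≢⇒1≤ rj≢ri) (c ∘ r) (map (both c) A))))
      where
      c = merge rj≢ri
      L = map neq (map (both r) E) ++ map pos A
      renamed : map (ren c) L ≡ map neq (map (both (c ∘ r)) E) ++ map pos (map (both c) A)
      renamed = trans (map-ren c (map (both r) E) A)
        (cong (λ E′ → map neq E′ ++ map pos (map (both c) A)) (sym (List.map-∘ E)))
      difference : ∀ n → # (G n) L ∸ # (G n) (map (ren c) L) ≡ # (G n) (neq (r i , r j) ∷ L)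
      difference n = trans (cong (_∸ # (G n) (map (ren c) L)) (#-neq-merge (G n) rj≢ri L))
        (ℕ.m+n∸n≡m (# (G n) (neq (r i , r j) ∷ L)) (# (G n) (map (ren c) L)))

    Inj⇒#-EC-suc : InjConverges → ∀ k → (1 ≤ k → ∀ E A → EventuallyConstant (λ n → # (G n) {k} (map neq E ++ map pos A))) →
      ∀ (U E A : List (Fin (suc k) × Fin (suc k))) → (∀ {i j} → i ≢ j → (i , j) ∈ E ⊎ (i , j) ∈ U) →
      EventuallyConstant (λ n → # (G n) (map neq E ++ map pos A))
    Inj⇒#-EC-suc inj k merged [] E A cover with Fin.any? (λ i → (i , i) ∈? E)
    -- Diagonal pairs arise when a merging identifies the two ends of a pair in `E`.
    ... | yes (i , ii∈E) = 0 , λ m n _ _ → trans (vanish m) (sym (vanish n))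
      where
      vanish : ∀ n → # (G n) (map neq E ++ map pos A) ≡ 0
      vanish n = #-neq-diagonal (G n) {L = map neq E ++ map pos A} i (∈-++⁺ˡ (∈-map⁺ neq ii∈E))
    -- Now `E` has exactly the off-diagonal pairs as members, so the count is the numerator of an
    -- injective density.
    ... | no noDiagonal = EC-cong
      (λ n → #-cong (G n)
        (⊆-trans (⊆-reflexive-↭ (++-comm A′ D)) (++⁺ (map⁺ neq offDiagonal⊆E) (map⁺ pos (edges-fromEdges⊆ 1≤k A))))
        (⊆-trans (++⁺ (map⁺ neq E⊆offDiagonal) (map⁺ pos (edges-fromEdges⊇ 1≤k A))) (⊆-reflexive-↭ (++-comm D A′))))
      (Converges⇒EC {λ n → # (G n) (A′ ++ D)} (#-distinct-EC (suc k)) (λ n → #-anti (G n) {L = D} {A′ ++ D} (∈-++⁺ʳ A′))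
        (Converges-cong (λ n → tinj-# (G n) F) (inj F)))
      where
      1≤k = s≤s z≤n
      F = fromEdges 1≤k A
      A′ = map pos (edges F)
      D = distinct (suc k)
      offDiagonal⊆E : offDiagonal (suc k) ⊆ E
      offDiagonal⊆E e∈ with cover (∈-offDiagonal⁻ e∈)
      ... | inj₁ e∈E = e∈E
      E⊆offDiagonal : E ⊆ offDiagonal (suc k)
      E⊆offDiagonal {i , j} e∈E = ∈-offDiagonal λ { refl → noDiagonal (i , e∈E) }
    Inj⇒#-EC-suc inj k merged ((i , j) ∷ U) E A cover with j Fin.≟ i
    ... | yes refl = Inj⇒#-EC-suc inj k merged U E A cover′
      where
      cover′ : ∀ {i′ j′} → i′ ≢ j′ → (i′ , j′) ∈ E ⊎ (i′ , j′) ∈ U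
      cover′ i′≢j′ with cover i′≢j′
      ... | inj₁ e∈E          = inj₁ e∈E
      ... | inj₂ (here refl)  = contradiction refl i′≢j′
      ... | inj₂ (there e∈U)  = inj₂ e∈U
    -- Lexicographic descent: either the pair moves from `U` to `E`, or the vertex number drops.
    -- After the drop `merged` starts afresh with all off-diagonal pairs undecided, whatever `E` has
    -- become.
    ... | no j≢i = EC-cong (λ n → sym (#-neq-merge (G n) j≢i L))
      (EC-map₂ {λ n → # (G n) (neq (i , j) ∷ L)} {λ n → # (G n) (map (ren c) L)} _+_
        (Inj⇒#-EC-suc inj k merged U ((i , j) ∷ E) A cover′)
        (subst (λ L′ → EventuallyConstant (λ n → # (G n) L′)) (sym (map-ren c E A))
          (merged (≢⇒1≤ j≢i) (map (both c) E) (map (both c) A))))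
      where
      c = merge j≢i
      L = map neq E ++ map pos A
      cover′ : ∀ {i′ j′} → i′ ≢ j′ → (i′ , j′) ∈ (i , j) ∷ E ⊎ (i′ , j′) ∈ U
      cover′ i′≢j′ with cover i′≢j′
      ... | inj₁ e∈E          = inj₁ (there e∈E)
      ... | inj₂ (here e≡)    = inj₁ (here e≡)
      ... | inj₂ (there e∈U)  = inj₂ e∈U

    Inj⇒#-EC : InjConverges → ∀ k → 1 ≤ k → ∀ E A → EventuallyConstant (λ n → # (G n) {k} (map neq E ++ map pos A))
    Inj⇒#-EC inj (suc k) _ E A = Inj⇒#-EC-suc inj k (Inj⇒#-EC inj k) (offDiagonal (suc k)) E A (inj₂ ∘ ∈-offDiagonal)

    Hom⇒Inj-EC : HomConverges → InjConverges
    Hom⇒Inj-EC hom F = Converges-cong (λ n → sym (tinj-# (G n) F))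
      (EC⇒Converges {λ n → # (G n) (A ++ D)} (#-distinct-EC k)
        (EC-cong (λ n → #-cong (G n) (⊆-reflexive-↭ (++-comm D A)) (⊆-reflexive-↭ (++-comm A D)))
          (subst (λ E → EventuallyConstant (λ n → # (G n) (map neq E ++ A))) (List.map-id (offDiagonal k))
            (Hom⇒#-EC hom (offDiagonal k) (Digraph.nonempty F) id (edges F)))))
      where
      k = size F
      A = map pos (edges F)
      D = distinct k

    Inj⇒Hom-EC : InjConverges → HomConverges
    Inj⇒Hom-EC inj F = Converges-cong (λ n → sym (t-# (G n) F))
      (EC⇒Converges {λ n → # (G n) (map pos (edges F))} (#-[]-EC (size F))
        (Inj⇒#-EC inj (size F) (Digraph.nonempty F) [] (edges F)))

  -- Homomorphism and injective densities for size tending to infinity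

  module _ (size→∞ : ConvergesToℕ∞ (λ n → size (G n)) nothing) where

    t-tinj-close : ∀ F ε → 0ℚ ℚ.< ε → ∃ λ M → ∀ n → M ≤ n → ∣ t F (G n) ℚ.- tinj F (G n) ∣ ℚ.< ε
    t-tinj-close F ε ε>0 with frac-small (length (offDiagonal (size F))) ε>0
    -- `K` makes the error term smaller than ε; `size F` ensures that injective maps exist, so that
    -- the injective density has a positive denominator.
    ... | K , small with size→∞ (K ⊔ size F)
    ... | M , large = M , λ n M≤n → ℚ.≤-<-trans
      (t-tinj-dist F (G n) (ℕ.m⊔n≤o⇒n≤o K (size F) (large n M≤n)))
      (small (size (G n)) (ℕ.m⊔n≤o⇒m≤o K (size F) (large n M≤n)))

    Hom⇒Inj-∞ : HomConverges → InjConverges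
    Hom⇒Inj-∞ hom F = Converges-close {λ n → t F (G n)} {λ n → tinj F (G n)} (t-tinj-close F) (hom F)

    Inj⇒Hom-∞ : InjConverges → HomConverges
    Inj⇒Hom-∞ inj F = Converges-close {λ n → tinj F (G n)} {λ n → t F (G n)}
      (λ ε ε>0 → let M , close = t-tinj-close F ε ε>0 in
        M , λ n M≤n → subst (ℚ._< ε) (∣p-q∣≡∣q-p∣ (t F (G n)) (tinj F (G n))) (close n M≤n))
      (inj F)

  const⇒EC : ∀ L → ConvergesToℕ∞ (λ n → size (G n)) (just L) → EventuallyConstant (λ n → size (G n))
  const⇒EC L (M , const) = M , λ m n M≤m M≤n → trans (const m M≤m) (sym (const n M≤n))

  Hom×Size⇒Inj : HomConverges → SizeConverges → InjConverges
  Hom×Size⇒Inj hom (just L  , const) = Hom⇒Inj-EC (const⇒EC L const) hom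
  Hom×Size⇒Inj hom (nothing , size→∞) = Hom⇒Inj-∞ size→∞ hom

  Inj×Size⇒Hom : InjConverges → SizeConverges → HomConverges
  Inj×Size⇒Hom inj (just L  , const) = Inj⇒Hom-EC (const⇒EC L const) inj
  Inj×Size⇒Hom inj (nothing , size→∞) = Inj⇒Hom-∞ size→∞ inj

  -- Convergence of the size

  tinj-edgeless : ∀ {k} (1≤k : 1 ≤ k) n → tinj (fromEdges 1≤k []) (G n) ≡ frac (sg (# (G n) (distinct k))) 1
  tinj-edgeless {k} 1≤k n = begin
    tinj (fromEdges 1≤k []) (G n) ≡⟨ tinj-# (G n) (fromEdges 1≤k []) ⟩
    tinjᴸ (map pos (edges (fromEdges 1≤k []))) n
      ≡⟨ tinjᴸ-cong (map⁺ pos (edges-fromEdges⊆ 1≤k [])) (map⁺ pos (edges-fromEdges⊇ 1≤k [])) n ⟩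
    frac (# (G n) (distinct k)) (# (G n) (distinct k)) ≡⟨ frac-self (# (G n) (distinct k)) ⟩
    frac (sg (# (G n) (distinct k))) 1 ∎
    where open ≡-Reasoning

  -- A convergent sequence with values 0 and 1 is eventually constant. The value is 1 exactly when k
  -- < |G n|, so each such comparison is eventually settled.
  threshold : InjConverges → ∀ k → EventuallyConstant (λ n → sg (# (G n) (distinct (suc k))))
  threshold inj k = Converges⇒EC {d = λ _ → 1} (0 , λ _ _ _ _ → refl) (λ n → sg≤1 (# (G n) (distinct (suc k))))
    (Converges-cong (tinj-edgeless (s≤s z≤n)) (inj (fromEdges {suc k} (s≤s z≤n) [])))

  -- If the sizes do not stabilise, induction on k shows that eventually k ≤ |G n|: by `threshold`,
  -- either k + 1 ≤ |G n| for all large n, or |G n| ≤ k for all large n, and the latter would make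
  -- the size eventually equal to k.
  Inj⇒Size : ExcludedMiddle 0ℓ → InjConverges → SizeConverges
  Inj⇒Size em inj with em {∃ λ L → ConvergesToℕ∞ (λ n → size (G n)) (just L)}
  ... | yes (L , const) = just L , const
  ... | no ¬const = nothing , unbounded
    where
    unbounded : ∀ k → ∃ λ M → ∀ n → M ≤ n → k ≤ size (G n)
    unbounded zero    = 0 , λ _ _ → z≤n
    unbounded (suc k) with unbounded k | threshold inj k
    -- Beyond both bounds the answer no longer changes, so testing the single index `M ⊔ M′` decides
    -- it for all later ones.
    ... | M , k≤ | M′ , same with suc k ℕ.≤? size (G (M ⊔ M′))
    ... | yes k< = M ⊔ M′ , λ n le → #-distinct-pos⁻ (G n) (suc k) (sg-transfer
          (same (M ⊔ M′) n (ℕ.m≤n⊔m M M′) (ℕ.m⊔n≤o⇒n≤o M M′ le)) (#-distinct-pos (G (M ⊔ M′)) (suc k) k<))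
    ... | no k≮ = contradiction (k , M ⊔ M′ , λ n le → ℕ.≤-antisym
        (ℕ.≮⇒≥ λ k<n → k≮ (#-distinct-pos⁻ (G (M ⊔ M′)) (suc k) (sg-transfer
          (same n (M ⊔ M′) (ℕ.m⊔n≤o⇒n≤o M M′ le) (ℕ.m≤n⊔m M M′)) (#-distinct-pos (G n) (suc k) k<n))))
        (k≤ n (ℕ.m⊔n≤o⇒m≤o M M′ le))) ¬const

-- From posets to digraphs

IsEdge : ∀ F → Fin (size F) → Fin (size F) → Set
IsEdge F i j = edge F i j ≡ true

Path : ∀ F → Fin (size F) → Fin (size F) → Set
Path F = TransClosure (IsEdge F)

-- Transitivity of the target extends a homomorphism from edges to paths. Hence passing to the
-- transitive closure loses no homomorphism, and a closed path would contradict irreflexivity.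
hom-Path : ∀ F P φ → isHom F (toDigraph P) φ ≡ true → ∀ {i j} → Path F i j → Poset.lt P (φ i) (φ j) ≡ true
hom-Path F P φ hom {i} {j} [ ij ] = ⇒b-true⁻ (forallPairs-true⁻ hom i j) ij
hom-Path F P φ hom {i} (_∷_ {y = j} ij jk) =
  Poset.trans P _ _ _ (⇒b-true⁻ (forallPairs-true⁻ hom i j) ij) (hom-Path F P φ hom jk)

IsStrictOrder : Digraph → Set
IsStrictOrder F = (∀ i → edge F i i ≡ false) × (∀ i j k → IsEdge F i j → IsEdge F j k → IsEdge F i k)

-- An induced map also reflects edges, so the order axioms pull back to F. Taking the closure is not
-- an option for t_ind, as added edges change which maps are induced; instead only strict orders
-- have non-zero density.
ind⇒IsStrictOrder : ∀ F P φ → isInd F (toDigraph P) φ ≡ true → IsStrictOrder F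
ind⇒IsStrictOrder F P φ ind =
  (λ i → trans (sym (iso i i)) (Poset.irrefl P (φ i))) ,
  (λ i j k ij jk → trans (sym (iso i k)) (Poset.trans P _ _ _ (trans (iso i j) ij) (trans (iso j k) jk)))
  where
  iso : ∀ i j → Poset.lt P (φ i) (φ j) ≡ edge F i j
  iso i j = ⇔b-true⁻ (forallPairs-true⁻ (∧-trueʳ {isInj φ} ind) i j)

module _ (em : ExcludedMiddle 0ℓ) where

  closure : (F : Digraph) → (∀ i → ¬ Path F i i) → Poset
  closure F acyclic = record
    { size     = size F
    ; nonempty = Digraph.nonempty F
    ; lt       = λ i j → does (em {Path F i j})
    ; irrefl   = λ i → dec-false em (acyclic i)
    ; trans    = λ i j k ij jk → dec-true em (reach ij ++ᵀ reach jk)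
    }
    where
    reach : ∀ {i j} → does (em {Path F i j}) ≡ true → Path F i j
    reach {i} {j} _ with yes path ← em {Path F i j} = path

  module _ (F : Digraph) (acyclic : ∀ i → ¬ Path F i i) (P : Poset) where
    private Q = toDigraph (closure F acyclic)

    closure-hom : ∀ φ → isHom F (toDigraph P) φ ≡ true → isHom Q (toDigraph P) φ ≡ true
    closure-hom φ hom = forallPairs-true λ i j → ⇒b-true {does (em {Path F i j})} (lift i j)
      where
      lift : ∀ i j → does (em {Path F i j}) ≡ true → Poset.lt P (φ i) (φ j) ≡ true
      lift i j _ with yes path ← em {Path F i j} = hom-Path F P φ hom path

    closure-hom⁻ : ∀ φ → isHom Q (toDigraph P) φ ≡ true → isHom F (toDigraph P) φ ≡ true
    closure-hom⁻ φ hom = forallPairs-true λ i j → ⇒b-true {edge F i j} λ ij →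
      ⇒b-true⁻ (forallPairs-true⁻ hom i j) (dec-true em [ ij ])

    t-closure : t Q (toDigraph P) ≡ t F (toDigraph P)
    t-closure = cong (λ x → frac x (length (maps F (toDigraph P)))) (count-cong (maps F (toDigraph P)) closure-hom⁻ closure-hom)

    tinj-closure : tinj Q (toDigraph P) ≡ tinj F (toDigraph P)
    tinj-closure = cong (λ x → frac x (count isInj (maps F (toDigraph P)))) (count-cong (maps F (toDigraph P))
      (λ φ s → ∧-true (∧-trueˡ s) (closure-hom⁻ φ (∧-trueʳ {isInj φ} s)))
      (λ φ s → ∧-true (∧-trueˡ s) (closure-hom φ (∧-trueʳ {isInj φ} s))))

  cyclic⇒¬hom : ∀ F P i → Path F i i → ∀ φ → isHom F (toDigraph P) φ ≢ true
  cyclic⇒¬hom F P i path φ hom =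
    contradiction (trans (sym (hom-Path F P φ hom path)) (Poset.irrefl P (φ i))) λ ()

  t-cyclic : ∀ F P i → Path F i i → t F (toDigraph P) ≡ 0ℚ
  t-cyclic F P i path = frac-0 (length (maps F (toDigraph P)))
    (count-false (maps F (toDigraph P)) λ φ → ≢true⇒false (cyclic⇒¬hom F P i path φ))

  tinj-cyclic : ∀ F P i → Path F i i → tinj F (toDigraph P) ≡ 0ℚ
  tinj-cyclic F P i path = frac-0 (count isInj (maps F (toDigraph P)))
    (count-false (maps F (toDigraph P)) λ φ → ≢true⇒false (cyclic⇒¬hom F P i path φ ∘ ∧-trueʳ {isInj φ}))

  module _ (P : ℕ → Poset) where

    t-posets⇒digraphs : (∀ Q → Converges (λ n → t (toDigraph Q) (Pd P n))) → HomConverges (Pd P)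
    t-posets⇒digraphs conv F with em {∃ λ i → Path F i i}
    ... | yes (i , path) = Converges-cong (λ n → sym (t-cyclic F (P n) i path)) (Converges-const 0ℚ)
    ... | no ¬cyclic     = Converges-cong (λ n → t-closure F acyclic (P n)) (conv (closure F acyclic))
      where
      acyclic : ∀ i → ¬ Path F i i
      acyclic i path = ¬cyclic (i , path)

    tinj-posets⇒digraphs : cond-ii P → cond-v P
    tinj-posets⇒digraphs conv F with em {∃ λ i → Path F i i}
    ... | yes (i , path) = Converges-cong (λ n → sym (tinj-cyclic F (P n) i path)) (Converges-const 0ℚ)
    ... | no ¬cyclic     = Converges-cong (λ n → tinj-closure F acyclic (P n)) (conv (closure F acyclic))
      where
      acyclic : ∀ i → ¬ Path F i i
      acyclic i path = ¬cyclic (i , path)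

    tind-posets⇒digraphs : cond-iii P → cond-vi P
    tind-posets⇒digraphs conv F with em {IsStrictOrder F}
    ... | yes (irr , tr) = conv (record
      { size = size F ; nonempty = Digraph.nonempty F ; lt = edge F ; irrefl = irr ; trans = tr })
    ... | no ¬order = Converges-cong (λ n → sym (vanish n)) (Converges-const 0ℚ)
      where
      vanish : ∀ n → tind F (Pd P n) ≡ 0ℚ
      vanish n = frac-0 (count isInj (maps F (Pd P n)))
        (count-false (maps F (Pd P n)) λ φ → ≢true⇒false (¬order ∘ ind⇒IsStrictOrder F (P n) φ))

theorem3p1 : ExcludedMiddle 0ℓ → (P : ℕ → Poset) →
    (cond-i P ⇔ cond-ii P) × (cond-i P ⇔ cond-iii P) × (cond-i P ⇔ cond-iv P)
    × (cond-i P ⇔ cond-v P) × (cond-i P ⇔ cond-vi P)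
theorem3p1 em P =
  mk⇔ (v⇒ii ∘ i⇒v) (v⇒i ∘ ii⇒v) ,
  mk⇔ (vi⇒iii ∘ v⇒vi ∘ i⇒v) (v⇒i ∘ vi⇒v ∘ iii⇒vi) ,
  mk⇔ i⇒iv iv⇒i ,
  mk⇔ i⇒v v⇒i ,
  mk⇔ (v⇒vi ∘ i⇒v) (v⇒i ∘ vi⇒v)
  where
  i⇒iv : cond-i P → cond-iv P
  i⇒iv (conv , sz) = t-posets⇒digraphs em P conv , sz
  iv⇒i : cond-iv P → cond-i P
  iv⇒i (conv , sz) = conv ∘ toDigraph , sz
  i⇒v : cond-i P → cond-v P
  i⇒v i = let conv , sz = i⇒iv i in Hom×Size⇒Inj (Pd P) conv sz
  v⇒i : cond-v P → cond-i P
  -- The limit of the sizes is found before the homomorphism densities, because the passage to them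
  -- is different for finite and infinite limits.
  v⇒i inj = let sz = Inj⇒Size (Pd P) em inj in iv⇒i (Inj×Size⇒Hom (Pd P) inj sz , sz)
  v⇒ii : cond-v P → cond-ii P
  v⇒ii conv = conv ∘ toDigraph
  ii⇒v : cond-ii P → cond-v P
  ii⇒v = tinj-posets⇒digraphs em P
  v⇒vi : cond-v P → cond-vi P
  v⇒vi = Inj⇒Ind (Pd P)
  vi⇒v : cond-vi P → cond-v P
  vi⇒v = Ind⇒Inj (Pd P)
  vi⇒iii : cond-vi P → cond-iii P
  vi⇒iii conv = conv ∘ toDigraph
  iii⇒vi : cond-iii P → cond-vi P
  iii⇒vi = tind-posets⇒digraphs em P
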